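{- Let $p$ be an odd positive integer and let $a,b$ be integers with $1\le a<b\le\lfloor\frac{3p-1}{2}\rfloor$, $\gcd(a,b)=1$, and $\frac{3p}{\gcd(3p,b)}=3s$ for some positive integer $s$. Then the circulant graph $C_{3p}(a,b)$ is Type I, i.e. its total chromatic number equals $5$.
   Context: For integers $n$ and $1\le d_1<d_2<\dots<d_l\le\lfloor n/2\rfloor$, the circulant graph $C_n(d_1,\dots,d_l)$ has vertex set $\{0,1,\dots,n-1\}$, with $x$ and $y$ adjacent iff $x\equiv y\pm d_i \pmod n$ for some $i$. The paper considers four-regular circulant graphs $C_n(a,b)$ with $1\le a<b\le\lfloor\frac{n-1}{2}\rfloor$. A total coloring of a graph $G$ assigns colors to vertices and edges so that adjacent vertices receive different colors, edges sharing an endpoint receive different colors, and each edge receives a color different from its two endpoints. The total chromatic number $\chi''(G)$ is the minimum number of colors in a total coloring; always $\chi''(G)\ge\Delta(G)+1$. A graph is Type I if $\chi''(G)=\Delta(G)+1$. -}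

module Defs where

open import Data.Nat using (ℕ; _+_; _*_; _<_)
open import Data.Fin using (Fin; toℕ)
open import Data.Product using (Σ; _×_; ∃)
open import Data.Sum using (_⊎_)
open import Relation.Binary.PropositionalEquality using (_≡_; _≢_)
open import Relation.Nullary using (¬_)

Graph : ℕ → Set₁
Graph n = Fin n → Fin n → Set

-- For x, y ∈ {0,…,n-1} and 0 ≤ d < n :  x ≡ y + d (mod n)
-- (since y + d < 2n, this holds iff y + d = x or y + d = x + n).
ShiftBy : (n d : ℕ) → Fin n → Fin n → Set
ShiftBy n d x y = (toℕ y + d ≡ toℕ x) ⊎ (toℕ y + d ≡ toℕ x + n)

PlusMinus : (n d : ℕ) → Fin n → Fin n → Set
PlusMinus n d x y = ShiftBy n d x y ⊎ ShiftBy n d y x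

Circulant₂ : (n a b : ℕ) → Graph n
Circulant₂ n a b x y = PlusMinus n a x y ⊎ PlusMinus n b x y

record TotalColoring {n : ℕ} (G : Graph n) (k : ℕ) : Set where
  field
    cv : Fin n → Fin k
    ce : Fin n → Fin n → Fin k
    ce-sym : ∀ x y → G x y → ce x y ≡ ce y x
    vertex-proper : ∀ x y → G x y → cv x ≢ cv y
    edge-proper : ∀ x y z → G x y → G x z → y ≢ z → ce x y ≢ ce x z
    incidence-proper : ∀ x y → G x y → (ce x y ≢ cv x) × (ce x y ≢ cv y)

TotalColorable : {n : ℕ} → Graph n → ℕ → Set
TotalColorable G k = TotalColoring G k

TotalChromaticNumber≡ : {n : ℕ} → Graph n → ℕ → Set
TotalChromaticNumber≡ G k = TotalColorable G k × (∀ m → m < k → ¬ TotalColorable G m)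

{-# OPTIONS --safe #-}

-- A total colouring with five colours amounts to a cell for every t modulo n, consisting of the colours of t
-- and of the edges to t + a and t + b; properness only involves the cells of t, t + a and t + b.  With
-- h = gcd n b and L = n / h (both odd) the integers modulo n form an h × L grid of h columns, the cosets of ⟨b⟩,
-- in which a leads from each column to the next and from the last to the first with a shift d.  After
-- replacing b by -b we have 2d < L.  Up to exchanging a and b there are three cases.
--
-- (1) h ≥ 3 and 3 ∣ L: colourings with period 3 along the columns.
--
-- (2) a and b are units, so that the grid is one cycle t ↦ t + 1 with chords t ↦ t + m, 3 ∤ m.  Colour vertices
-- by their residues modulo 3 with 2, 3, 4, each chord with the third of these colours, and the cycle edges
-- alternately with 0 and 1.  As the cycle is odd, three of its edges, at distance m, get colour 2 instead;
-- next to them 2 is replaced by whichever of 0 and 1 is missing, and since the three edges are joined by chords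
-- the two ends of a chord agree about this.
--
-- (3) h ≥ 3 and 3 ∤ L: no colouring has period 3 along the columns.  There are two defects, at rows 0 and d, so
-- that the twist takes the first to the second; between them the colouring has period 3, and the remaining
-- conditions depend on a bounded part of the grid only.  The finite tables come from a computer search.
module Submission where

open import Defs
open import Data.Bool using (Bool; true; false; not)
import Data.Bool.Properties as Boolₚ
open import Data.Fin as Fin using (Fin; zero; suc; toℕ; fromℕ<; #_)
import Data.Fin.Properties as Finₚ
open import Data.Integer as ℤ using (ℤ; +_; -_; _-_)
open import Data.Integer.DivMod using (_%ℕ_; _/ℕ_; n%ℕd<d; a≡a%ℕn+[a/ℕn]*n)
open import Data.Integer.Divisibility.Signed
  using ( _∣_; divides; _∣?_; ∣ᵤ⇒∣; ∣⇒∣ᵤ; ∣-trans; ∣m∣n⇒∣m+n; ∣m∣n⇒∣m-n; ∣m⇒∣-m; ∣n⇒∣m*n; ∣m⇒∣m*n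
        ; *-monoʳ-∣; *-cancelˡ-∣ )
import Data.Integer.Properties as ℤₚ
open import Data.Integer.Tactic.RingSolver using (solve-∀)
open import Data.List using (List; []; _∷_)
open import Data.List.Membership.Propositional using (_∈_)
open import Data.List.Relation.Unary.All as All using (All; []; _∷_)
open import Data.List.Relation.Unary.Any using (here; there)
open import Data.Nat as ℕ using (ℕ; zero; suc; _+_; _*_; _∸_; _/_; _≤_; _<_; z≤n; s≤s; NonZero)
open import Data.Nat.Coprimality using (coprime-divisor; gcd≡1⇒coprime)
import Data.Nat.Divisibility as ℕ∣
open import Data.Nat.DivMod
  using ( _%_; _mod_; m%n<n; m<n⇒m%n≡m; m%n%n≡m%n; m≡m%n+[m/n]*n; m/n*n≤m; m*n%n≡0; [m+n]%n≡m%n; [m+kn]%n≡m%n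
        ; %-distribˡ-+; %-distribˡ-* )
open import Data.Nat.GCD
  using (gcd; gcd-GCD; gcd[m,n]∣m; gcd[m,n]∣n; gcd-greatest; gcd-comm; module Bézout)
import Data.Nat.Properties as ℕₚ
open import Data.Product using (_×_; ∃; ∃₂; _,_; proj₁; proj₂; uncurry)
open import Data.Sum using (_⊎_; inj₁; inj₂; [_,_]′)
open import Function using (_∘_)
open import Relation.Binary.PropositionalEquality
  using (_≡_; _≢_; refl; sym; trans; cong; cong₂; subst; subst₂; ≢-sym)
open import Relation.Nullary using (¬_; Dec; yes; no; contradiction; ¬?)
open import Relation.Nullary.Decidable using (map′; from-yes; _×-dec_; _→-dec_)

-- Colour patterns on the integers

-- For a vertex t, edge₁ leads to t + a and edge₂ to t + b.
record Cell : Set where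
  constructor cell
  field
    vertex edge₁ edge₂ : Fin 5
open Cell

-- Here x, y, z are the cells of t, t + a, t + b; the last pair consists of the edges entering t + a + b.
Compatible : Cell → Cell → Cell → Set
Compatible x y z = All (uncurry _≢_)
  ( (vertex x , edge₁ x) ∷ (vertex x , edge₂ x) ∷ (edge₁ x , edge₂ x)
  ∷ (vertex x , vertex y) ∷ (vertex x , vertex z)
  ∷ (edge₁ x , vertex y) ∷ (edge₁ x , edge₁ y) ∷ (edge₁ x , edge₂ y)
  ∷ (edge₂ x , vertex z) ∷ (edge₂ x , edge₁ z) ∷ (edge₂ x , edge₂ z)
  ∷ (edge₁ z , edge₂ y) ∷ [])

-- Colours live on ℤ and a, b are integers, so that b can be replaced by -b and vertices such as t -
-- b need no reduction modulo n.
record Pattern (n : ℕ) (a b : ℤ) : Set where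
  field
    colour     : ℤ → Cell
    periodic   : ∀ s t → + n ∣ s - t → colour s ≡ colour t
    compatible : ∀ t → Compatible (colour t) (colour (t ℤ.+ a)) (colour (t ℤ.+ b))
open Pattern

pattern-swap : ∀ {n a b} → Pattern n b a → Pattern n a b
pattern-swap P = record
  { colour     = swap ∘ colour P
  ; periodic   = λ s t d → cong swap (periodic P s t d)
  ; compatible = swap-compatible ∘ compatible P
  }
  where
  swap : Cell → Cell
  swap (cell v e f) = cell v f e
  swap-compatible : ∀ {x y z} → Compatible x y z → Compatible (swap x) (swap z) (swap y)
  swap-compatible (p₁ ∷ p₂ ∷ p₃ ∷ p₄ ∷ p₅ ∷ p₆ ∷ p₇ ∷ p₈ ∷ p₉ ∷ p₁₀ ∷ p₁₁ ∷ p₁₂ ∷ []) =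
    p₂ ∷ p₁ ∷ ≢-sym p₃ ∷ p₅ ∷ p₄ ∷ p₉ ∷ p₁₁ ∷ p₁₀ ∷ p₆ ∷ p₈ ∷ p₇ ∷ ≢-sym p₁₂ ∷ []

-- The edge between t and t + b leaves t + b along -b, so the new cell at t takes `edge₂` from t +
-- b. Its conditions are collected from the old ones at t, t + b and t + 2b.
pattern-reverse : ∀ {n a b} → Pattern n a (- b) → Pattern n a b
pattern-reverse {n} {a} {b} P = record
  { colour     = λ t → reversed (colour P t) (colour P (t ℤ.+ b))
  ; periodic   = λ s t d → cong₂ reversed (periodic P s t d)
      (periodic P (s ℤ.+ b) (t ℤ.+ b) (subst (+ n ∣_) (shift-both s t b) d))
  ; compatible = λ t → combine
      {colour P t} {colour P (t ℤ.+ a)} {colour P (t ℤ.+ b)} {colour P (t ℤ.+ a ℤ.+ b)} {colour P (t ℤ.+ b ℤ.+ b)}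
      (compatible P t) (at t (compatible P (t ℤ.+ b)))
      (subst (λ u → Compatible (colour P (t ℤ.+ b ℤ.+ b)) (colour P (t ℤ.+ b ℤ.+ b ℤ.+ a)) (colour P u))
          (back (t ℤ.+ b) b)
        (compatible P (t ℤ.+ b ℤ.+ b)))
  }
  where
  reversed : Cell → Cell → Cell
  reversed (cell v e _) (cell _ _ f) = cell v e f
  shift-both : ∀ s t b → s - t ≡ s ℤ.+ b - (t ℤ.+ b)
  shift-both = solve-∀
  back : ∀ t b → t ℤ.+ b ℤ.+ - b ≡ t
  back = solve-∀
  exchange : ∀ t b a → t ℤ.+ b ℤ.+ a ≡ t ℤ.+ a ℤ.+ b
  exchange = solve-∀
  at : ∀ t → Compatible (colour P (t ℤ.+ b)) (colour P (t ℤ.+ b ℤ.+ a)) (colour P (t ℤ.+ b ℤ.+ - b)) →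
       Compatible (colour P (t ℤ.+ b)) (colour P (t ℤ.+ a ℤ.+ b)) (colour P t)
  at t p rewrite back t b | exchange t b a = p
  combine : ∀ {x y z w s r q} → Compatible x y r → Compatible z w x → Compatible s q z →
            Compatible (reversed x z) (reversed y w) (reversed z s)
  combine (p₁ ∷ _ ∷ _ ∷ p₄ ∷ _ ∷ p₆ ∷ p₇ ∷ _) (_ ∷ q₂ ∷ q₃ ∷ _ ∷ q₅ ∷ _ ∷ _ ∷ q₈ ∷ q₉ ∷ q₁₀ ∷ _ ∷ q₁₂ ∷ [])
          (_ ∷ _ ∷ _ ∷ _ ∷ _ ∷ _ ∷ _ ∷ _ ∷ _ ∷ _ ∷ r₁₁ ∷ _) =
    p₁ ∷ ≢-sym q₉ ∷ ≢-sym q₁₀ ∷ p₄ ∷ ≢-sym q₅ ∷ p₆ ∷ p₇ ∷ q₁₂ ∷ ≢-sym q₂ ∷ ≢-sym q₃ ∷ ≢-sym r₁₁ ∷ q₈ ∷ []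

-- From patterns to total colourings

∣-small : ∀ {n k} → + n ∣ + k → k < n → k ≡ 0
∣-small {n} {k} d k<n with ∣⇒∣ᵤ d
... | n∣k with k
...   | zero  = refl
...   | suc j = contradiction (ℕ∣.∣⇒≤ n∣k) (ℕₚ.<⇒≱ k<n)

congruent⇒≡ : ∀ {n i j} → i < n → j < n → + n ∣ + i - + j → i ≡ j
congruent⇒≡ {n} {i} {j} i<n j<n d with ℕₚ.≤-total j i
... | inj₁ j≤i = ℕₚ.≤-antisym (ℕₚ.m∸n≡0⇒m≤n (∣-small (subst (+ n ∣_) (difference j≤i) d) (ℕₚ.≤-<-trans
    (ℕₚ.m∸n≤m i j) i<n))) j≤i
  where
  difference : ∀ {i j} → j ≤ i → + i - + j ≡ + (i ∸ j)
  difference {i} {j} j≤i = trans (ℤₚ.[+m]-[+n]≡m⊖n i j) (ℤₚ.⊖-≥ j≤i)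
... | inj₂ i≤j = ℕₚ.≤-antisym i≤j (ℕₚ.m∸n≡0⇒m≤n (∣-small (subst (+ n ∣_) (difference i≤j) (∣m⇒∣-m d)) (ℕₚ.≤-<-trans
    (ℕₚ.m∸n≤m j i) j<n)))
  where
  negate : ∀ x y → - (x - y) ≡ y - x
  negate = solve-∀
  difference : ∀ {i j} → j ≤ i → - (+ j - + i) ≡ + (i ∸ j)
  difference {i} {j} j≤i = trans (negate (+ j) (+ i)) (trans (ℤₚ.[+m]-[+n]≡m⊖n i j) (ℤₚ.⊖-≥ j≤i))

module _ {n a b : ℕ} (0<a : 0 < a) (a<b : a < b) (2b<n : b + b < n) where

  record Arc (d : ℕ) (x y : Fin n) : Set where
    constructor arc
    field congruent : ℤ.+ n ∣ + toℕ x ℤ.+ + d - + toℕ y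
  open Arc

  shift⇒arc : ∀ d x y → ShiftBy n d y x → Arc d x y
  shift⇒arc d x y (inj₁ e) =
    arc (divides (+ 0) (subst (λ k → + k - + toℕ y ≡ + 0) (sym e) (ℤₚ.+-inverseʳ (+ toℕ y))))
  shift⇒arc d x y (inj₂ e) =
    arc (divides (+ 1) (subst (λ k → + k - + toℕ y ≡ + 1 ℤ.* + n) (sym e) (one-turn (+ toℕ y) (+ n))))
    where
    one-turn : ∀ y n → y ℤ.+ n - y ≡ + 1 ℤ.* n
    one-turn = solve-∀

  data Neighbour (x y : Fin n) : Set where
    forward₁  : Arc a x y → Neighbour x y
    backward₁ : Arc a y x → Neighbour x y
    forward₂  : Arc b x y → Neighbour x y
    backward₂ : Arc b y x → Neighbour x y

  neighbour : ∀ x y → Circulant₂ n a b x y → Neighbour x y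
  neighbour x y (inj₁ (inj₁ s)) = backward₁ (shift⇒arc a y x s)
  neighbour x y (inj₁ (inj₂ s)) = forward₁ (shift⇒arc a x y s)
  neighbour x y (inj₂ (inj₁ s)) = backward₂ (shift⇒arc b y x s)
  neighbour x y (inj₂ (inj₂ s)) = forward₂ (shift⇒arc b x y s)

  arc? : ∀ d x y → Dec (Arc d x y)
  arc? d x y = map′ arc congruent (+ n ∣? ℤ.+ toℕ x ℤ.+ + d - + toℕ y)

  private
    a<n : a < n
    a<n = ℕₚ.<-trans a<b (ℕₚ.≤-<-trans (ℕₚ.m≤m+n b b) 2b<n)
    a+b<n : a + b < n
    a+b<n = ℕₚ.<-trans (ℕₚ.+-monoˡ-< b a<b) 2b<n
    a+a<n : a + a < n
    a+a<n = ℕₚ.<-trans (ℕₚ.+-monoʳ-< a a<b) a+b<n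
    0<b : 0 < b
    0<b = ℕₚ.<-trans 0<a a<b

    -- Going from x to y by c and back by d would close a walk of length c + d, which lies strictly
    -- between 0 and n.
    opposite : ∀ {c d x y} → 0 < c → c + d < n → Arc c x y → ¬ Arc d y x
    opposite {c} {d} {x} {y} 0<c c+d<n s t =
      ℕₚ.<⇒≢ (ℕₚ.<-≤-trans 0<c (ℕₚ.m≤m+n c d))
        (sym (∣-small (subst (+ n ∣_) (lemma (+ toℕ x) (+ toℕ y) (+ c) (+ d)) (∣m∣n⇒∣m+n (congruent s)
            (congruent t))) c+d<n))
      where
      lemma : ∀ x y c d → (x ℤ.+ c - y) ℤ.+ (y ℤ.+ d - x) ≡ c ℤ.+ d
      lemma = solve-∀

    same : ∀ {x y} → Arc a x y → ¬ Arc b x y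
    same {x} {y} s t = ℕₚ.<⇒≢ a<b (congruent⇒≡ a<n (ℕₚ.≤-<-trans (ℕₚ.m≤m+n b b) 2b<n)
        (subst (+ n ∣_) (lemma (+ toℕ x) (+ toℕ y) (+ a) (+ b)) (∣m∣n⇒∣m-n (congruent s) (congruent t))))
      where
      lemma : ∀ x y c d → (x ℤ.+ c - y) - (x ℤ.+ d - y) ≡ c - d
      lemma = solve-∀

  target-unique : ∀ {d x y z} → Arc d x y → Arc d x z → y ≡ z
  target-unique {d} {x} {y} {z} s t = Finₚ.toℕ-injective (congruent⇒≡ (Finₚ.toℕ<n y) (Finₚ.toℕ<n z)
      (subst (+ n ∣_) (lemma (+ toℕ x) (+ toℕ y) (+ toℕ z) (+ d)) (∣m∣n⇒∣m-n (congruent t) (congruent s))))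
    where
    lemma : ∀ x y z d → (x ℤ.+ d - z) - (x ℤ.+ d - y) ≡ y - z
    lemma = solve-∀

  source-unique : ∀ {d x y z} → Arc d y x → Arc d z x → y ≡ z
  source-unique {d} {x} {y} {z} s t = Finₚ.toℕ-injective (congruent⇒≡ (Finₚ.toℕ<n y) (Finₚ.toℕ<n z)
      (subst (+ n ∣_) (lemma (+ toℕ x) (+ toℕ y) (+ toℕ z) (+ d)) (∣m∣n⇒∣m-n (congruent s) (congruent t))))
    where
    lemma : ∀ x y z d → (y ℤ.+ d - x) - (z ℤ.+ d - x) ≡ y - z
    lemma = solve-∀

  module _ (P : Pattern n (+ a) (+ b)) where

    at : Fin n → Cell
    at x = colour P (+ toℕ x)

    at-shift : ∀ {d x y} → Arc d x y → colour P (+ toℕ x ℤ.+ + d) ≡ at y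
    at-shift s = periodic P _ _ (congruent s)

    along₁ : ∀ {x y} → Arc a x y → ∃ λ z → Compatible (at x) (at y) z
    along₁ {x} {y} s = _ , subst (λ c → Compatible (at x) c (colour P (+ toℕ x ℤ.+ + b))) (at-shift s) (compatible P
        (+ toℕ x))

    along₂ : ∀ {x y} → Arc b x y → ∃ λ z → Compatible (at x) z (at y)
    along₂ {x} {y} s = _ , subst (Compatible (at x) (colour P (+ toℕ x ℤ.+ + a))) (at-shift s) (compatible P
        (+ toℕ x))

    -- The two edges entering x are compared in the condition at y - b, the fourth corner of the
    -- parallelogram: from there b leads to y, and a leads to z modulo n.
    meet : ∀ {x y z} → Arc a y x → Arc b z x → edge₁ (at y) ≢ edge₂ (at z)
    meet {x} {y} {z} s t with compatible P (+ toℕ y - + b)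
    ... | _ ∷ _ ∷ _ ∷ _ ∷ _ ∷ _ ∷ _ ∷ _ ∷ _ ∷ _ ∷ _ ∷ p ∷ [] =
      subst (λ c → edge₁ c ≢ edge₂ (at z)) (cong (colour P) (lemma (+ toℕ y) (+ b)))
        (subst (λ c → edge₁ (colour P (+ toℕ y - + b ℤ.+ + b)) ≢ edge₂ c)
          (periodic P _ _ (subst (+ n ∣_) (lemma₂ (+ toℕ x) (+ toℕ y) (+ toℕ z) (+ a) (+ b))
              (∣m∣n⇒∣m-n (congruent s) (congruent t))))
          p)
      where
      lemma : ∀ y b → y - b ℤ.+ b ≡ y
      lemma = solve-∀
      lemma₂ : ∀ x y z a b → (y ℤ.+ a - x) - (z ℤ.+ b - x) ≡ y - b ℤ.+ a - z
      lemma₂ = solve-∀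

    edge-colour : Fin n → Fin n → Fin 5
    edge-colour x y with arc? a x y | arc? a y x | arc? b x y
    ... | yes _ | _     | _     = edge₁ (at x)
    ... | no _  | yes _ | _     = edge₁ (at y)
    ... | no _  | no _  | yes _ = edge₂ (at x)
    -- For neighbours only the step b from y to x is left; for all other pairs the colour is
    -- arbitrary.
    ... | no _  | no _  | no _  = edge₂ (at y)

    colour-of : ∀ {x y} → Neighbour x y → Fin 5
    colour-of {x} {y} (forward₁ _)  = edge₁ (at x)
    colour-of {x} {y} (backward₁ _) = edge₁ (at y)
    colour-of {x} {y} (forward₂ _)  = edge₂ (at x)
    colour-of {x} {y} (backward₂ _) = edge₂ (at y)

    -- As 0 < a < b < n / 2, two vertices are joined in one direction only, so the search in
    -- `edge-colour` finds the direction of N.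
    edge-colour-of : ∀ {x y} (N : Neighbour x y) → edge-colour x y ≡ colour-of N
    edge-colour-of {x} {y} N with arc? a x y | arc? a y x | arc? b x y
    edge-colour-of (forward₁ _)  | yes _ | _ | _ = refl
    edge-colour-of (backward₁ s) | yes t | _ | _ = contradiction s (opposite 0<a a+a<n t)
    edge-colour-of (forward₂ s)  | yes t | _ | _ = contradiction s (same t)
    edge-colour-of (backward₂ s) | yes t | _ | _ = contradiction s (opposite 0<a a+b<n t)
    edge-colour-of (forward₁ s)  | no ¬s | _ | _ = contradiction s ¬s
    edge-colour-of (backward₁ _) | no _ | yes _ | _ = refl
    edge-colour-of (forward₂ s)  | no _ | yes t | _ = contradiction s (opposite 0<a a+b<n t)
    edge-colour-of (backward₂ s) | no _ | yes t | _ = contradiction s (same t)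
    edge-colour-of (backward₁ s) | no _ | no ¬s | _ = contradiction s ¬s
    edge-colour-of (forward₂ _)  | no _ | no _ | yes _ = refl
    edge-colour-of (backward₂ s) | no _ | no _ | yes t = contradiction s (opposite 0<b 2b<n t)
    edge-colour-of (forward₂ s)  | no _ | no _ | no ¬s = contradiction s ¬s
    edge-colour-of (backward₂ _) | no _ | no _ | no _ = refl

    -- Edges in the same direction have the same other end; each of the six pairs of different
    -- directions is an entry of `Compatible` at a suitable vertex.
    colour-of-proper : ∀ {x y z} (M : Neighbour x y) (N : Neighbour x z) → y ≢ z → colour-of M ≢ colour-of N
    colour-of-proper {x} (forward₁ s) (forward₁ t) y≢z = contradiction (target-unique {x = x} s t) y≢z
    colour-of-proper (forward₁ s) (backward₁ t) _ with along₁ t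
    ... | _ , _ ∷ _ ∷ _ ∷ _ ∷ _ ∷ _ ∷ p ∷ _ = ≢-sym p
    colour-of-proper {x} (forward₁ s) (forward₂ t) _ with compatible P (+ toℕ x)
    ... | _ ∷ _ ∷ p ∷ _ = p
    colour-of-proper (forward₁ s) (backward₂ t) _ with along₂ t
    ... | _ , _ ∷ _ ∷ _ ∷ _ ∷ _ ∷ _ ∷ _ ∷ _ ∷ _ ∷ p ∷ _ = ≢-sym p
    colour-of-proper (backward₁ s) (backward₁ t) y≢z = contradiction (source-unique s t) y≢z
    colour-of-proper (backward₁ s) (forward₂ t) _ with along₁ s
    ... | _ , _ ∷ _ ∷ _ ∷ _ ∷ _ ∷ _ ∷ _ ∷ p ∷ _ = p
    colour-of-proper (backward₁ s) (backward₂ t) _ = meet s t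
    colour-of-proper {x} (forward₂ s) (forward₂ t) y≢z = contradiction (target-unique {x = x} s t) y≢z
    colour-of-proper (forward₂ s) (backward₂ t) _ with along₂ t
    ... | _ , _ ∷ _ ∷ _ ∷ _ ∷ _ ∷ _ ∷ _ ∷ _ ∷ _ ∷ _ ∷ p ∷ _ = ≢-sym p
    colour-of-proper (backward₂ s) (backward₂ t) y≢z = contradiction (source-unique s t) y≢z
    colour-of-proper M@(backward₁ _) N@(forward₁ _)  y≢z = ≢-sym (colour-of-proper N M (≢-sym y≢z))
    colour-of-proper M@(forward₂ _)  N@(forward₁ _)  y≢z = ≢-sym (colour-of-proper N M (≢-sym y≢z))
    colour-of-proper M@(forward₂ _)  N@(backward₁ _) y≢z = ≢-sym (colour-of-proper N M (≢-sym y≢z))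
    colour-of-proper M@(backward₂ _) N@(forward₁ _)  y≢z = ≢-sym (colour-of-proper N M (≢-sym y≢z))
    colour-of-proper M@(backward₂ _) N@(backward₁ _) y≢z = ≢-sym (colour-of-proper N M (≢-sym y≢z))
    colour-of-proper M@(backward₂ _) N@(forward₂ _)  y≢z = ≢-sym (colour-of-proper N M (≢-sym y≢z))

    flip : ∀ {x y} → Neighbour x y → Neighbour y x
    flip (forward₁ s)  = backward₁ s
    flip (backward₁ s) = forward₁ s
    flip (forward₂ s)  = backward₂ s
    flip (backward₂ s) = forward₂ s

    colour-of-flip : ∀ {x y} (N : Neighbour x y) → colour-of N ≡ colour-of (flip N)
    colour-of-flip (forward₁ s)  = refl
    colour-of-flip (backward₁ s) = refl
    colour-of-flip (forward₂ s)  = refl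
    colour-of-flip (backward₂ s) = refl

    ends-proper : ∀ {x y} → Neighbour x y → vertex (at x) ≢ vertex (at y)
    ends-proper (forward₁ s) with along₁ s
    ... | _ , _ ∷ _ ∷ _ ∷ p ∷ _ = p
    ends-proper (forward₂ s) with along₂ s
    ... | _ , _ ∷ _ ∷ _ ∷ _ ∷ p ∷ _ = p
    ends-proper N@(backward₁ _) = ≢-sym (ends-proper (flip N))
    ends-proper N@(backward₂ _) = ≢-sym (ends-proper (flip N))

    source-proper : ∀ {x y} (N : Neighbour x y) → colour-of N ≢ vertex (at x)
    source-proper {x} (forward₁ s) with compatible P (+ toℕ x)
    ... | p ∷ _ = ≢-sym p
    source-proper {x} (forward₂ s) with compatible P (+ toℕ x)
    ... | _ ∷ p ∷ _ = ≢-sym p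
    source-proper (backward₁ s) with along₁ s
    ... | _ , _ ∷ _ ∷ _ ∷ _ ∷ _ ∷ p ∷ _ = p
    source-proper (backward₂ s) with along₂ s
    ... | _ , _ ∷ _ ∷ _ ∷ _ ∷ _ ∷ _ ∷ _ ∷ _ ∷ p ∷ _ = p

    total-colouring : TotalColoring (Circulant₂ n a b) 5
    total-colouring = record
      { cv = vertex ∘ at
      ; ce = edge-colour
      ; ce-sym = λ x y g → let N = neighbour x y g in
          trans (edge-colour-of N) (trans (colour-of-flip N) (sym (edge-colour-of (flip N))))
      ; vertex-proper = λ x y g → ends-proper (neighbour x y g)
      ; edge-proper = λ x y z g h y≢z e → let M = neighbour x y g; N = neighbour x z h in
          colour-of-proper M N y≢z (trans (sym (edge-colour-of M)) (trans e (edge-colour-of N)))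
      ; incidence-proper = λ x y g → let N = neighbour x y g in
          (λ e → source-proper N (trans (sym (edge-colour-of N)) e)) ,
          (λ e → source-proper (flip N) (trans (sym (colour-of-flip N)) (trans (sym (edge-colour-of N)) e)))
      }

-- Five colours are necessary

module _ {n a b : ℕ} (0<a : 0 < a) (a<b : a < b) (2b<n : b + b < n) where
  private
    b<n : b < n
    b<n = ℕₚ.≤-<-trans (ℕₚ.m≤m+n b b) 2b<n
    b≤n : b ≤ n
    b≤n = ℕₚ.<⇒≤ b<n
    a≤n : a ≤ n
    a≤n = ℕₚ.≤-trans (ℕₚ.<⇒≤ a<b) b≤n
    b<n∸b : b < n ∸ b
    b<n∸b = ℕₚ.m+n≤o⇒m≤o∸n (suc b) 2b<n
    n∸b<n∸a : n ∸ b < n ∸ a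
    n∸b<n∸a = ℕₚ.∸-monoʳ-< a<b b≤n

    origin : Fin n
    origin = fromℕ< (ℕₚ.≤-<-trans z≤n b<n)

    -- The neighbours of 0 in increasing order, so that their distinctness amounts to a < b < n - b
    -- < n - a.
    position : Fin 4 → ℕ
    position zero                   = a
    position (suc zero)             = b
    position (suc (suc zero))       = n ∸ b
    position (suc (suc (suc zero))) = n ∸ a

    position<n : ∀ i → position i < n
    position<n zero                   = ℕₚ.<-trans a<b b<n
    position<n (suc zero)             = b<n
    position<n (suc (suc zero))       = ℕₚ.∸-monoʳ-< (ℕₚ.<-trans 0<a a<b) b≤n
    position<n (suc (suc (suc zero))) = ℕₚ.∸-monoʳ-< 0<a a≤n

    position-increasing : ∀ {i j} → i Fin.< j → position i < position j
    position-increasing {zero}           {suc zero}             _ = a<b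
    position-increasing {zero}           {suc (suc zero)}       _ = ℕₚ.<-trans a<b b<n∸b
    position-increasing {zero}           {suc (suc (suc zero))} _ = ℕₚ.<-trans a<b (ℕₚ.<-trans b<n∸b n∸b<n∸a)
    position-increasing {suc zero}       {suc (suc zero)}       _ = b<n∸b
    position-increasing {suc zero}       {suc (suc (suc zero))} _ = ℕₚ.<-trans b<n∸b n∸b<n∸a
    position-increasing {suc (suc zero)} {suc (suc (suc zero))} _ = n∸b<n∸a
    position-increasing {suc zero}       {suc zero}             (s≤s ())
    position-increasing {suc (suc zero)} {suc zero}             (s≤s ())
    position-increasing {suc (suc zero)} {suc (suc zero)}       (s≤s (s≤s ()))
    position-increasing {suc (suc (suc zero))} {suc zero} (s≤s ())
    position-increasing {suc (suc (suc zero))} {suc (suc zero)} (s≤s (s≤s ()))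
    position-increasing {suc (suc (suc zero))} {suc (suc (suc zero))} (s≤s (s≤s (s≤s ())))

    neighbours : Fin 4 → Fin n
    neighbours i = fromℕ< (position<n i)

    adjacent : ∀ i → Circulant₂ n a b origin (neighbours i)
    adjacent i with toℕ origin | Finₚ.toℕ-fromℕ< (ℕₚ.≤-<-trans z≤n b<n) | toℕ (neighbours i) | Finₚ.toℕ-fromℕ<
        (position<n i)
    adjacent zero                   | _ | refl | _ | refl = inj₁ (inj₂ (inj₁ refl))
    adjacent (suc zero)             | _ | refl | _ | refl = inj₂ (inj₂ (inj₁ refl))
    adjacent (suc (suc zero))       | _ | refl | _ | refl = inj₂ (inj₁ (inj₂ (ℕₚ.m∸n+n≡m b≤n)))
    adjacent (suc (suc (suc zero))) | _ | refl | _ | refl = inj₁ (inj₁ (inj₂ (ℕₚ.m∸n+n≡m a≤n)))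

    neighbours-distinct : ∀ {i j} → i Fin.< j → neighbours i ≢ neighbours j
    neighbours-distinct {i} {j} i<j e = ℕₚ.<⇒≢ (position-increasing i<j)
      (trans (sym (Finₚ.toℕ-fromℕ< (position<n i))) (trans (cong toℕ e) (Finₚ.toℕ-fromℕ< (position<n j))))

  -- No two of vertex 0 and its four edges can share a colour, so the pigeonhole principle applies
  -- to these five objects.
  no-fewer-colours : ∀ m → m < 5 → ¬ TotalColorable (Circulant₂ n a b) m
  no-fewer-colours m m<5 T =
    let _ , _ , i<j , e = Finₚ.pigeonhole m<5 palette in palette-distinct i<j e
    where
    open TotalColoring T
    palette : Fin 5 → Fin m
    palette zero    = cv origin
    palette (suc i) = ce origin (neighbours i)
    palette-distinct : ∀ {i j} → i Fin.< j → palette i ≢ palette j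
    palette-distinct {zero}  {suc j} _         e = proj₁ (incidence-proper _ _ (adjacent j)) (sym e)
    palette-distinct {suc i} {suc j} (s≤s i<j) e =
      edge-proper _ _ _ (adjacent i) (adjacent j) (neighbours-distinct i<j) e

-- Twisted tori

-- Addition of d modulo L as a relation: for d ≤ L and j < L one wrap is enough, and matching on the
-- proof tells whether it happens.
Step : (L d j k : ℕ) → Set
Step L d j k = k < L × (d + j ≡ k ⊎ d + j ≡ L + k)

step : ∀ {L d j} → d ≤ L → j < L → ∃ λ k → Step L d j k
step {L} {d} {j} d≤L j<L with d + j ℕₚ.<? L
... | yes p = d + j , p , inj₁ refl
... | no ¬p = d + j ∸ L , ℕₚ.+-cancelˡ-< L _ _ (subst (_< L + L) (sym L+k) (ℕₚ.+-mono-≤-< d≤L j<L)) , inj₂ (sym L+k)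
  where
  L+k : L + (d + j ∸ L) ≡ d + j
  L+k = ℕₚ.m+[n∸m]≡n (ℕₚ.≮⇒≥ ¬p)

recolour : ∀ {x x′ y y′ z z′} → x ≡ x′ → y ≡ y′ → z ≡ z′ → Compatible x′ y′ z′ → Compatible x y z
recolour refl refl refl c = c

-- An h × L grid in which each column is a cycle of length L and column h is column 0 shifted by d.
record TwistedTorus (h L d : ℕ) : Set where
  field
    colour : ℕ → ℕ → Cell
    inner  : ∀ {i j k} → suc i < h → j < L → Step L 1 j k →
             Compatible (colour i j) (colour (suc i) j) (colour i k)
    outer  : ∀ {i j k l} → suc i ≡ h → j < L → Step L 1 j k → Step L d j l →
             Compatible (colour i j) (colour 0 l) (colour i k)

module _
  {h L d : ℕ} .{{_ : NonZero h}} .{{_ : NonZero L}} {a b u v w : ℤ}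
  (bézout  : ℤ.+ (h * L) ∣ u ℤ.* a ℤ.+ v ℤ.* b - + 1)
  (inverse : ℤ.+ (h * L) ∣ w ℤ.* b - + h)
  (h∣b     : ℤ.+ h ∣ b)
  (turn    : ℤ.+ (h * L) ∣ + h ℤ.* a - + d ℤ.* b)
  (d≤L     : d ≤ L)
  where

  private
    n : ℤ
    n = + (h * L)

    n≡hL : n ≡ + h ℤ.* + L
    n≡hL = ℤₚ.pos-* h L

    h∣n : ℤ.+ h ∣ n
    h∣n = divides (+ L) (trans n≡hL (ℤₚ.*-comm (+ h) (+ L)))

    n∣Lb : n ∣ + L ℤ.* b
    n∣Lb = subst₂ _∣_ (trans (ℤₚ.*-comm (+ L) (+ h)) (sym n≡hL)) refl (*-monoʳ-∣ (+ L) h∣b)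

  record Coordinates (t : ℤ) (i j : ℕ) : Set where
    constructor coordinates
    field
      i<h       : i < h
      j<L       : j < L
      congruent : n ∣ + i ℤ.* a ℤ.+ + j ℤ.* b - t

  -- By `bézout`, t ≡ t u a + t v b. Writing t u = i + q h, `turn` trades q h a for q d b; then the
  -- coefficient of b is reduced modulo L, since n ∣ L b.
  locate : ∀ t → ∃₂ (Coordinates t)
  locate t = i , j , coordinates (n%ℕd<d X h) (n%ℕd<d Y L)
      (subst (n ∣_) (sym residue)
        (∣m∣n⇒∣m-n (∣m∣n⇒∣m-n (∣n⇒∣m*n t bézout) (∣n⇒∣m*n q turn)) (∣n⇒∣m*n r n∣Lb)))
    where
    X = t ℤ.* u
    i = X %ℕ h
    q = X /ℕ h
    Y = t ℤ.* v ℤ.+ q ℤ.* + d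
    j = Y %ℕ L
    r = Y /ℕ L
    isolate : ∀ x y z → x ≡ y ℤ.+ z → y ≡ x - z
    isolate x y z refl = lemma y z
      where
      lemma : ∀ y z → y ≡ y ℤ.+ z - z
      lemma = solve-∀
    expand : ∀ t u v a b q r d h L → (t ℤ.* u - q ℤ.* h) ℤ.* a ℤ.+ (t ℤ.* v ℤ.+ q ℤ.* d - r ℤ.* L) ℤ.* b - t
           ≡ t ℤ.* (u ℤ.* a ℤ.+ v ℤ.* b - + 1) - q ℤ.* (h ℤ.* a - d ℤ.* b) - r ℤ.* (L ℤ.* b)
    expand = solve-∀
    residue : ℤ.+ i ℤ.* a ℤ.+ + j ℤ.* b - t ≡ t ℤ.* (u ℤ.* a ℤ.+ v ℤ.* b - + 1) - q ℤ.*
        (+ h ℤ.* a - + d ℤ.* b) - r ℤ.* (+ L ℤ.* b)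
    residue = trans
      (cong₂ (λ x y → x ℤ.* a ℤ.+ y ℤ.* b - t) (isolate X (+ i) (q ℤ.* + h) (a≡a%ℕn+[a/ℕn]*n X h)) (isolate Y (+ j)
          (r ℤ.* + L) (a≡a%ℕn+[a/ℕn]*n Y L)))
      (expand t u v a b q r (+ d) (+ h) (+ L))

  module _ {t i j k l} (C : Coordinates t i j) (C′ : Coordinates t k l) where
    private
      open Coordinates
      -- Modulo h, both n and b vanish and u a ≡ 1, so multiplying the difference of the two
      -- congruences by u leaves i - k.
      same-column : i ≡ k
      same-column = congruent⇒≡ (i<h C) (i<h C′) (subst (+ h ∣_) (sym (lemma (+ i) (+ j) (+ k) (+ l) a b u v t))
        (∣m∣n⇒∣m+n (∣m∣n⇒∣m-n (∣n⇒∣m*n u (∣-trans h∣n (∣m∣n⇒∣m-n (congruent C) (congruent C′))))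
            (∣n⇒∣m*n (u ℤ.* (+ j - + l)) h∣b))
                   (∣m∣n⇒∣m-n (∣n⇒∣m*n ((+ i - + k) ℤ.* v) h∣b) (∣n⇒∣m*n (+ i - + k) (∣-trans h∣n bézout)))))
        where
        lemma : ∀ i j k l a b u v t → i - k
              ≡ u ℤ.* ((i ℤ.* a ℤ.+ j ℤ.* b - t) - (k ℤ.* a ℤ.+ l ℤ.* b - t)) - u ℤ.* (j - l) ℤ.* b ℤ.+
                ((i - k) ℤ.* v ℤ.* b - (i - k) ℤ.* (u ℤ.* a ℤ.+ v ℤ.* b - + 1))
        lemma = solve-∀

      -- With i = k, multiplying by w turns (j - l) b into (j - l) h modulo h L, and h cancels.
      same-row : j ≡ l
      same-row = congruent⇒≡ (j<L C) (j<L C′) (*-cancelˡ-∣ (+ h) (subst₂ _∣_ n≡hL (sym (lemma (+ i) (+ j) (+ l) a b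
          (+ h) w t))
        (∣m∣n⇒∣m-n (∣n⇒∣m*n w (∣m∣n⇒∣m-n (congruent C)
                     (subst (λ x → n ∣ + x ℤ.* a ℤ.+ + l ℤ.* b - t) (sym same-column) (congruent C′))))
                   (∣n⇒∣m*n (+ j - + l) inverse))))
        where
        lemma : ∀ i j l a b h w t → h ℤ.* (j - l)
              ≡ w ℤ.* ((i ℤ.* a ℤ.+ j ℤ.* b - t) - (i ℤ.* a ℤ.+ l ℤ.* b - t)) - (j - l) ℤ.* (w ℤ.* b - h)
        lemma = solve-∀

    coordinates-unique : i ≡ k × j ≡ l
    coordinates-unique = same-column , same-row

  torus⇒pattern : TwistedTorus h L d → Pattern (h * L) a b
  torus⇒pattern T = record
    { colour = paint
    ; periodic = λ s t d → let i , j , coordinates i<h j<L p = locate s in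
        sym (paint-coordinates (coordinates i<h j<L (subst (n ∣_) (retarget (+ i ℤ.* a ℤ.+ + j ℤ.* b) s t)
            (∣m∣n⇒∣m+n p d))))
    ; compatible = λ t → let _ , _ , C = locate t in
        compatible-at C (proj₂ (step (ℕ.>-nonZero⁻¹ L) (Coordinates.j<L C))) (proj₂ (step d≤L (Coordinates.j<L C)))
            (_ ℕₚ.<? h)
    }
    where
    module T = TwistedTorus T
    paint : ℤ → Cell
    paint t = let i , j , _ = locate t in T.colour i j

    paint-coordinates : ∀ {t i j} → Coordinates t i j → paint t ≡ T.colour i j
    paint-coordinates {t} c = let _ , _ , c′ = locate t ; e , f = coordinates-unique c′ c in cong₂ T.colour e f

    retarget : ∀ x s t → x - s ℤ.+ (s - t) ≡ x - t
    retarget = solve-∀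

    wrap : ∀ m {j k} → m + j ≡ k ⊎ m + j ≡ L + k → n ∣ (+ k - (+ m ℤ.+ + j)) ℤ.* b
    wrap m {j} {k} (inj₁ e) = divides (+ 0)
      (trans (cong (λ x → (+ k - + x) ℤ.* b) e) (cong (ℤ._* b) (ℤₚ.+-inverseʳ (+ k))))
    wrap m {j} {k} (inj₂ e) = subst (n ∣_)
      (trans (lemma (+ L) (+ k) b) (cong (λ x → (+ k - + x) ℤ.* b) (sym e))) (∣m⇒∣-m n∣Lb)
      where
      lemma : ∀ L k b → - (L ℤ.* b) ≡ (k - (L ℤ.+ k)) ℤ.* b
      lemma = solve-∀

    module _ {t i j k l} (C : Coordinates t i j) (K : Step L 1 j k) (M : Step L d j l) where
      open Coordinates C renaming (congruent to p)

      up : paint (t ℤ.+ b) ≡ T.colour i k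
      up = paint-coordinates (coordinates i<h (proj₁ K)
        (subst (n ∣_) (lemma (+ i) (+ j) (+ k) a b t) (∣m∣n⇒∣m+n p (wrap 1 (proj₂ K)))))
        where
        lemma : ∀ i j k a b t → i ℤ.* a ℤ.+ j ℤ.* b - t ℤ.+ (k - (+ 1 ℤ.+ j)) ℤ.* b ≡ i ℤ.* a ℤ.+ k ℤ.* b - (t ℤ.+ b)
        lemma = solve-∀

      right : suc i < h → paint (t ℤ.+ a) ≡ T.colour (suc i) j
      right 1+i<h = paint-coordinates (coordinates 1+i<h j<L (subst (n ∣_) (lemma (+ i) (+ j) a b t) p))
        where
        lemma : ∀ i j a b t → i ℤ.* a ℤ.+ j ℤ.* b - t ≡ (+ 1 ℤ.+ i) ℤ.* a ℤ.+ j ℤ.* b - (t ℤ.+ a)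
        lemma = solve-∀

      -- From the last column a leads to i + 1 = h steps of a, and h a ≡ d b moves this to column 0
      -- with d added to the row.
      around : suc i ≡ h → paint (t ℤ.+ a) ≡ T.colour 0 l
      around 1+i≡h = paint-coordinates (coordinates (ℕ.>-nonZero⁻¹ h) (proj₁ M)
        (subst (n ∣_) (lemma (+ i) (+ j) (+ l) (+ d) a b t)
          (∣m∣n⇒∣m-n (∣m∣n⇒∣m+n p (wrap d (proj₂ M)))
                     (subst (λ x → n ∣ + x ℤ.* a - + d ℤ.* b) (sym 1+i≡h) turn))))
        where
        lemma : ∀ i j l d a b t → i ℤ.* a ℤ.+ j ℤ.* b - t ℤ.+ (l - (d ℤ.+ j)) ℤ.* b - ((+ 1 ℤ.+ i) ℤ.* a - d ℤ.* b)
              ≡ + 0 ℤ.* a ℤ.+ l ℤ.* b - (t ℤ.+ a)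
        lemma = solve-∀

      last-column : ¬ suc i < h → suc i ≡ h
      last-column ¬1+i<h = ℕₚ.≤-antisym i<h (ℕₚ.≮⇒≥ ¬1+i<h)

      compatible-at : Dec (suc i < h) → Compatible (paint t) (paint (t ℤ.+ a)) (paint (t ℤ.+ b))
      compatible-at (yes p) = recolour (paint-coordinates C) (right p) up (T.inner p j<L K)
      compatible-at (no ¬p) =
        recolour (paint-coordinates C) (around (last-column ¬p)) up (T.outer (last-column ¬p) j<L K M)

-- Colourings given by tables

compatible? : ∀ x y z → Dec (Compatible x y z)
compatible? x y z = All.all? (λ (c , c′) → ¬? (c Finₚ.≟ c′)) _

below? : ∀ {P : ℕ → Set} → (∀ i → Dec (P i)) → ∀ v → Dec (∀ {i} → i < v → P i)
below? = ℕₚ.allUpTo?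

-- One list per column class; the cell (v , e₁ , e₂) is written as the decimal number v e₁ e₂.
Table : Set
Table = List (List ℕ)

nth : {A : Set} → A → List A → ℕ → A
nth z []       _       = z
nth z (x ∷ _)  zero    = x
nth z (_ ∷ xs) (suc i) = nth z xs i

entry : Table → ℕ → ℕ → Cell
entry T x j = cell ((m / 100) mod 5) ((m / 10 % 10) mod 5) ((m % 10) mod 5)
  -- A position outside the table reads as (0 , 0 , 0), a cell that violates its own conditions, so
  -- a table that is too short fails its check.
  where m = nth 0 (nth [] T x) j

-- The classes of columns 0, 1, …, 2g + 2 are 0, 1, 3, 1, 3, …, 1, 2.
column-class : ℕ → ℕ → ℕ
column-class _ zero    = 0
column-class g (suc x) = inside g x
  where
  inside : ℕ → ℕ → ℕ
  inside zero    zero          = 1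
  inside zero    (suc _)       = 2
  inside (suc _) zero          = 1
  inside (suc _) (suc zero)    = 3
  inside (suc g) (suc (suc x)) = inside g x

-- These are all the transitions except the one from the last column to column 0, so four checks
-- cover every odd width from 3 on.
consecutive-classes : List (ℕ × ℕ)
consecutive-classes = (0 , 1) ∷ (1 , 2) ∷ (1 , 3) ∷ (3 , 1) ∷ []

width : ℕ → ℕ
width g = 3 + g * 2

column-classes-consecutive : ∀ g {x} → suc x < width g →
  (column-class g x , column-class g (suc x)) ∈ consecutive-classes
column-classes-consecutive zero    {zero}        _ = here refl
column-classes-consecutive (suc g) {zero}        _ = here refl
column-classes-consecutive zero    {suc zero}    _ = there (here refl)
column-classes-consecutive zero    {suc (suc _)} (s≤s (s≤s (s≤s ())))
column-classes-consecutive (suc _) {suc zero}    _ = there (there (here refl))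
column-classes-consecutive (suc zero)    {suc (suc zero)} _ = there (there (there (here refl)))
column-classes-consecutive (suc (suc _)) {suc (suc zero)} _ = there (there (there (here refl)))
column-classes-consecutive (suc g) {suc (suc (suc x))} (s≤s (s≤s p)) = column-classes-consecutive g {suc x} p

last-column-class : ∀ g {x} → suc x ≡ width g → column-class g x ≡ 2
last-column-class zero    refl = refl
last-column-class (suc g) refl = last-column-class g refl

step-unique : ∀ d j {L k l} → Step L d j k → Step L d j l → k ≡ l
step-unique _ _ (_ , inj₁ e) (_ , inj₁ f) = trans (sym e) f
step-unique _ _ {L} (_ , inj₂ e) (_ , inj₂ f) = ℕₚ.+-cancelˡ-≡ L _ _ (trans (sym e) f)
step-unique _ _ {L} {l = l} (k<L , inj₁ e) (_ , inj₂ f) = contradiction (ℕₚ.m≤m+n L l)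
    (ℕₚ.<⇒≱ (subst (_< L) (trans (sym e) f) k<L))
step-unique _ _ {L} {k = k} (_ , inj₂ e) (l<L , inj₁ f) = contradiction (ℕₚ.m≤m+n L k)
    (ℕₚ.<⇒≱ (subst (_< L) (trans (sym f) e) l<L))

splice : {A : Set} → ℕ → (ℕ → A) → (ℕ → A) → ℕ → A
splice zero    f g j       = g j
splice (suc k) f g zero    = f zero
splice (suc k) f g (suc j) = splice k (f ∘ suc) g j

splice-< : ∀ {A : Set} k {f g : ℕ → A} {j} → j < k → splice k f g j ≡ f j
splice-< (suc k) {j = zero}  _       = refl
splice-< (suc k) {j = suc _} (s≤s p) = splice-< k p

splice-+ : ∀ {A : Set} k {f g : ℕ → A} i → splice k f g (k + i) ≡ g i
splice-+ zero    i = refl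
splice-+ (suc k) i = splice-+ k i

split : ∀ k {l j} → j < k + l → j < k ⊎ (∃ λ i → j ≡ k + i × i < l)
split zero                j<l       = inj₂ (_ , refl , j<l)
split (suc k) {j = zero}  _         = inj₁ (s≤s z≤n)
split (suc k) {j = suc j} (s≤s j<) with split k j<
... | inj₁ p             = inj₁ (s≤s p)
... | inj₂ (i , refl , p) = inj₂ (i , refl , p)

-- Colourings with a fixed period along the columns

module Periodic (P δ : ℕ) .{{_ : NonZero P}} (T : Table) where

  Valid : Set
  Valid =
    All (λ (x , y) → ∀ {j} → j < P →
      Compatible (entry T x j) (entry T y j) (entry T x (suc j % P))) consecutive-classes
    × (∀ {j} → j < P → Compatible (entry T 2 j) (entry T 0 ((δ + j) % P)) (entry T 2 (suc j % P)))

  valid? : Dec Valid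
  valid? = All.all? (λ (x , y) → below? (λ j → compatible? _ _ _) P) consecutive-classes
           ×-dec below? (λ j → compatible? _ _ _) P

  -- Wrapping subtracts the number of rows q P, a multiple of the period.
  step-residue : ∀ {q d j k} → Step (q * P) d j k → k % P ≡ (d + j % P) % P
  step-residue {q} {d} {j} {k} (_ , s) = trans (go s)
    (trans (%-distribˡ-+ d j P) (trans (cong (λ x → (d % P + x) % P) (sym (m%n%n≡m%n j P)))
        (sym (%-distribˡ-+ d (j % P) P))))
    where
    go : d + j ≡ k ⊎ d + j ≡ q * P + k → k % P ≡ (d + j) % P
    go (inj₁ e) = cong (_% P) (sym e)
    go (inj₂ e) = sym (trans (cong (_% P) (trans e (ℕₚ.+-comm (q * P) k))) ([m+kn]%n≡m%n k q P))

  torus : Valid → ∀ g q d → d % P ≡ δ → TwistedTorus (width g) (q * P) d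
  torus (V , W) g q d d%P≡δ = record
    { colour = λ i j → entry T (column-class g i) (j % P)
    ; inner  = λ {i} {j} i<h j<L K → recolour refl refl (cong (entry T (column-class g i)) (step-residue {q} K))
        (All.lookup V (column-classes-consecutive g i<h) (m%n<n j P))
    ; outer  = λ {i} {j} i≡h j<L K M → outer i≡h K M
    }
    where
    outer : ∀ {i j k l} → suc i ≡ width g → Step (q * P) 1 j k → Step (q * P) d j l →
            Compatible (entry T (column-class g i) (j % P)) (entry T 0 (l % P)) (entry T (column-class g i) (k % P))
    outer {i} {j} {k} {l} i≡h K M rewrite last-column-class g i≡h =
      recolour refl (cong (entry T 0) twisted) (cong (entry T 2) (step-residue {q} K)) (W (m%n<n j P))
      where
      twisted : l % P ≡ (δ + j % P) % P
      twisted = trans (step-residue {q} M) (trans (%-distribˡ-+ d (j % P) P)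
        (trans (cong₂ (λ x y → (x + y) % P) d%P≡δ (m%n%n≡m%n j P)) refl))

-- Eventually periodic rows and colourings with two zones

fold : ℕ → ℕ → ℕ
fold zero    (suc (suc (suc i))) = fold zero i
fold zero    i                   = i
fold (suc _) zero                = zero
fold (suc k) (suc i)             = suc (fold k i)

fold-bound : ∀ k i → fold k i < k + 3
fold-bound zero    zero                = s≤s z≤n
fold-bound zero    (suc zero)          = s≤s (s≤s z≤n)
fold-bound zero    (suc (suc zero))    = s≤s (s≤s (s≤s z≤n))
fold-bound zero    (suc (suc (suc i))) = fold-bound zero i
fold-bound (suc k) zero                = s≤s z≤n
fold-bound (suc k) (suc i)             = s≤s (fold-bound k i)

fold-periodic : ∀ {k i} → k ≤ i → fold k (3 + i) ≡ fold k i
fold-periodic z≤n     = refl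
fold-periodic (s≤s p) = cong suc (fold-periodic p)

-- `fold K` removes periods from i only at or above K; in c + i they lie at or above c + K ≥ k,
-- where `fold k` ignores them.
fold-absorbs : ∀ {k K} c i → k ≤ c + K → fold k (c + fold K i) ≡ fold k (c + i)
fold-absorbs {K = zero}  c zero             p = refl
fold-absorbs {K = zero}  c (suc zero)       p = refl
fold-absorbs {K = zero}  c (suc (suc zero)) p = refl
fold-absorbs {k} {zero}  c (suc (suc (suc i))) p = trans (fold-absorbs c i p)
  (trans (sym (fold-periodic (ℕₚ.≤-trans p (ℕₚ.+-monoʳ-≤ c z≤n)))) (cong (fold k) (sym three)))
  where
  three : c + suc (suc (suc i)) ≡ suc (suc (suc (c + i)))
  three = trans (ℕₚ.+-suc c _) (cong suc (trans (ℕₚ.+-suc c _) (cong suc (ℕₚ.+-suc c i))))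
fold-absorbs {K = suc K} c zero    p = refl
fold-absorbs {k} {suc K} c (suc i) p = trans (cong (fold k) (ℕₚ.+-suc c _))
  (trans (fold-absorbs (suc c) i (subst (k ≤_) (ℕₚ.+-suc c K) p)) (cong (fold k) (sym (ℕₚ.+-suc c i))))

fold-residue : ∀ i → fold 0 i ≡ i % 3
fold-residue zero                = refl
fold-residue (suc zero)          = refl
fold-residue (suc (suc zero))    = refl
fold-residue (suc (suc (suc i))) = trans (fold-residue i)
  (trans (sym ([m+kn]%n≡m%n i 1 3)) (cong (_% 3) (ℕₚ.+-comm i 3)))

-- Rows 0, …, d - 1 form the lower zone and the others the upper zone, so that the twist takes row i of
-- the lower zone to row i of the upper one.  A zone begins with k exceptional rows and continues with
-- period 3; row i of a zone depends on fold k i only.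
module TwoZones (k₁ k₂ : ℕ) (T : Table) where

  lower upper : ℕ → ℕ → Cell
  lower x i = entry T x (fold k₁ i)
  -- The first k₁ + 3 rows of the table belong to the lower zone.
  upper x i = entry T x (k₁ + 3 + fold k₂ i)

  -- Row i may be the last of its zone: an admissible zone consists of its k exceptional rows and
  -- whole periods, and the other zone starts above it.
  ends₁ ends₂ : ℕ → Set
  ends₁ i = fold k₁ (suc i) ≡ k₁
  ends₂ i = fold k₂ (suc i) ≡ k₂

  Inner : ℕ × ℕ → ℕ → Set
  Inner (x , y) i =
    Compatible (lower x i) (lower y i) (lower x (suc i)) ×
    (ends₁ i → Compatible (lower x i) (lower y i) (upper x 0)) ×
    Compatible (upper x i) (upper y i) (upper x (suc i)) ×
    (ends₂ i → Compatible (upper x i) (upper y i) (lower x 0))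

  -- With L = 2 d + m rows the upper zone has m + d rows. The twist adds d: lower row i goes to
  -- upper row i, upper row i with i < m goes to upper row d + i, and upper row m + i passes the top
  -- to lower row i. Of d and m, the checks below only use what the admissible zone lengths say
  -- about them.
  LowerToUpper : ℕ → Set
  LowerToUpper i =
    Compatible (lower 2 i) (upper 0 i) (lower 2 (suc i)) ×
    (ends₁ i → Compatible (lower 2 i) (upper 0 i) (upper 2 0))

  UpperToUpper : ℕ → ℕ → Set
  UpperToUpper d i = fold k₁ d ≡ k₁ → Compatible (upper 2 i) (upper 0 (d + i)) (upper 2 (suc i))

  UpperToLower : ℕ → ℕ → Set
  UpperToLower m i = 0 < m → (k₁ + m) % 3 ≡ k₂ % 3 →
    Compatible (upper 2 (m + i)) (lower 0 i) (upper 2 (suc (m + i))) ×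
    (ends₁ i → ends₂ (m + i) → Compatible (upper 2 (m + i)) (lower 0 i) (lower 2 0))

  Valid : Set
  Valid =
    -- For k₁, k₂ ≤ 7 every row, and also d and m, may be replaced by its image under `fold 7`.
    -- These images are below 10, hence the bound 10 in all checks.
    (k₁ ≤ 7 × k₂ ≤ 7 × 0 < k₁) ×
    All (λ p → ∀ {i} → i < 10 → Inner p i) consecutive-classes ×
    (∀ {i} → i < 10 → LowerToUpper i) ×
    (∀ {d} → d < 10 → ∀ {i} → i < 10 → UpperToUpper d i) ×
    (∀ {m} → m < 10 → ∀ {i} → i < 10 → UpperToLower m i)

  valid? : Dec Valid
  valid? =
    (k₁ ℕₚ.≤? 7 ×-dec k₂ ℕₚ.≤? 7 ×-dec 0 ℕₚ.<? k₁) ×-dec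
    All.all? (λ p → below? (λ i →
      compatible? _ _ _ ×-dec (ends₁? i →-dec compatible? _ _ _) ×-dec
      compatible? _ _ _ ×-dec (ends₂? i →-dec compatible? _ _ _)) 10) consecutive-classes ×-dec
    below? (λ i → compatible? _ _ _ ×-dec (ends₁? i →-dec compatible? _ _ _)) 10 ×-dec
    below? (λ d → below? (λ i → fold k₁ d ℕₚ.≟ k₁ →-dec compatible? _ _ _) 10) 10 ×-dec
    below? (λ m → below? (λ i → 0 ℕₚ.<? m →-dec ((k₁ + m) % 3 ℕₚ.≟ k₂ % 3 →-dec
      (compatible? _ _ _ ×-dec (ends₁? i →-dec (ends₂? (m + i) →-dec compatible? _ _ _))))) 10) 10
    where
    ends₁? : ∀ i → Dec (ends₁ i)
    ends₁? i = fold k₁ (suc i) ℕₚ.≟ k₁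
    ends₂? : ∀ i → Dec (ends₂ i)
    ends₂? i = fold k₂ (suc i) ℕₚ.≟ k₂

  module _ (V : Valid) where
    private
      k₁≤7 : k₁ ≤ 7
      k₁≤7 = let (p , _ , _) , _ = V in p
      k₂≤7 : k₂ ≤ 7
      k₂≤7 = let (_ , p , _) , _ = V in p

      r : ℕ → ℕ
      r = fold 7

      reduce₁ : ∀ {k} → k ≤ 7 → ∀ c i → fold k (c + r i) ≡ fold k (c + i)
      reduce₁ p c i = fold-absorbs c i (ℕₚ.≤-trans p (ℕₚ.m≤n+m 7 c))

      reduce₂ : ∀ {k} → k ≤ 7 → ∀ c i j → fold k (c + (r i + r j)) ≡ fold k (c + (i + j))
      reduce₂ {k} p c i j = trans (cong (fold k) (sym (ℕₚ.+-assoc c (r i) (r j))))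
        (trans (reduce₁ p (c + r i) j)
        (trans (cong (fold k) (rotate (r i)))
        (trans (reduce₁ p (c + j) i) (cong (fold k) (trans (sym (rotate i)) (ℕₚ.+-assoc c i j))))))
        where
        rotate : ∀ x → c + x + j ≡ c + j + x
        rotate x = trans (ℕₚ.+-assoc c x j) (trans (cong (_+_ c) (ℕₚ.+-comm x j)) (sym (ℕₚ.+-assoc c j x)))

      lower≡ : ∀ x {i j} → fold k₁ i ≡ fold k₁ j → lower x j ≡ lower x i
      lower≡ x e = cong (entry T x) (sym e)
      upper≡ : ∀ x {i j} → fold k₂ i ≡ fold k₂ j → upper x j ≡ upper x i
      upper≡ x e = cong (λ c → entry T x (k₁ + 3 + c)) (sym e)

      inner-valid : ∀ {p} → p ∈ consecutive-classes → ∀ i → Inner p i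
      inner-valid {x , y} p∈ i with All.lookup (proj₁ (proj₂ V)) p∈ (fold-bound 7 i)
      ... | A , B , C , D =
        recolour (lower≡ x (reduce₁ k₁≤7 0 i)) (lower≡ y (reduce₁ k₁≤7 0 i)) (lower≡ x (reduce₁ k₁≤7 1 i)) A ,
        (λ e → recolour (lower≡ x (reduce₁ k₁≤7 0 i)) (lower≡ y (reduce₁ k₁≤7 0 i)) refl
            (B (trans (reduce₁ k₁≤7 1 i) e))) ,
        recolour (upper≡ x (reduce₁ k₂≤7 0 i)) (upper≡ y (reduce₁ k₂≤7 0 i)) (upper≡ x (reduce₁ k₂≤7 1 i)) C ,
        (λ e → recolour (upper≡ x (reduce₁ k₂≤7 0 i)) (upper≡ y (reduce₁ k₂≤7 0 i)) refl
            (D (trans (reduce₁ k₂≤7 1 i) e)))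

      lower-to-upper : ∀ i → LowerToUpper i
      lower-to-upper i with proj₁ (proj₂ (proj₂ V)) (fold-bound 7 i)
      ... | A , B =
        recolour (lower≡ 2 (reduce₁ k₁≤7 0 i)) (upper≡ 0 (reduce₁ k₂≤7 0 i)) (lower≡ 2 (reduce₁ k₁≤7 1 i)) A ,
        (λ e → recolour (lower≡ 2 (reduce₁ k₁≤7 0 i)) (upper≡ 0 (reduce₁ k₂≤7 0 i)) refl
            (B (trans (reduce₁ k₁≤7 1 i) e)))

      upper-to-upper : ∀ d i → UpperToUpper d i
      upper-to-upper d i e =
        recolour (upper≡ 2 (reduce₁ k₂≤7 0 i)) (upper≡ 0 (reduce₂ k₂≤7 0 d i)) (upper≡ 2 (reduce₁ k₂≤7 1 i))
          (proj₁ (proj₂ (proj₂ (proj₂ V))) (fold-bound 7 d) (fold-bound 7 i) (trans (reduce₁ k₁≤7 0 d) e))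

      reduced-positive : ∀ K {m} → 0 < m → 0 < fold (suc K) m
      reduced-positive K (s≤s _) = s≤s z≤n

      residue : ∀ c m → (c + r m) % 3 ≡ (c + m) % 3
      residue c m = trans (sym (fold-residue (c + r m))) (trans (fold-absorbs {K = 7} c m z≤n) (fold-residue (c + m)))

      upper-to-lower : ∀ m i → UpperToLower m i
      upper-to-lower m i 0<m e with proj₂ (proj₂ (proj₂ (proj₂ V))) (fold-bound 7 m) (fold-bound 7 i)
                                      (reduced-positive 6 0<m) (trans (residue k₁ m) e)
      ... | A , B =
        recolour (upper≡ 2 (reduce₂ k₂≤7 0 m i)) (lower≡ 0 (reduce₁ k₁≤7 0 i)) (upper≡ 2 (reduce₂ k₂≤7 1 m i)) A ,
        (λ f g → recolour (upper≡ 2 (reduce₂ k₂≤7 0 m i)) (lower≡ 0 (reduce₁ k₁≤7 0 i)) refl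
          (B (trans (reduce₁ k₁≤7 1 i) f) (trans (reduce₂ k₂≤7 1 m i) g)))

    module _ (g : ℕ) {d m : ℕ} (d≡k₁ : fold k₁ d ≡ k₁) (m+d≡k₂ : fold k₂ (m + d) ≡ k₂)
             (0<m : 0 < m) (k₁+m≡k₂ : (k₁ + m) % 3 ≡ k₂ % 3) where
      private
        L : ℕ
        L = d + (m + d)

        0<d : 0 < d
        0<d = positive d d≡k₁ (let (_ , _ , p) , _ = V in p)
          where
          positive : ∀ {k} d → fold k d ≡ k → 0 < k → 0 < d
          positive {suc _} zero    ()
          positive         (suc _) _ _ = s≤s z≤n

        class : ℕ → ℕ
        class = column-class g

        data Row : ℕ → Set where
          low : ∀ {i} → i < d → Row i
          upp : ∀ {i} → i < m + d → Row (d + i)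

        row : ∀ {j} → j < L → Row j
        row j<L with split d j<L
        ... | inj₁ p             = low p
        ... | inj₂ (_ , refl , p) = upp p

        tint : ℕ → ℕ → Cell
        tint x = splice d (lower (class x)) (upper (class x))

        tint-low : ∀ x {i} → i < d → tint x i ≡ lower (class x) i
        tint-low x = splice-< d

        tint-upp : ∀ x i → tint x (d + i) ≡ upper (class x) i
        tint-upp x = splice-+ d

        data Above₁ (x i k : ℕ) : Set where
          stay : tint x k ≡ lower (class x) (suc i) → Above₁ x i k
          leave : suc i ≡ d → tint x k ≡ upper (class x) 0 → Above₁ x i k

        data Above₂ (x i k : ℕ) : Set where
          stay  : tint x k ≡ upper (class x) (suc i) → Above₂ x i k
          leave : suc i ≡ m + d → tint x k ≡ lower (class x) 0 → Above₂ x i k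

        zone≤ : ∀ {i} → i < m + d → d + i < L
        zone≤ = ℕₚ.+-monoʳ-< d

        next-low : ∀ x {i k} → i < d → Step L 1 i k → Above₁ x i k
        next-low x {i} {k} i<d K with suc i ℕₚ.<? d
        ... | yes p = stay (trans (cong (tint x) (step-unique 1 i K (ℕₚ.<-≤-trans p (ℕₚ.m≤m+n d _) , inj₁ refl)))
            (tint-low x p))
        ... | no ¬p = leave end (trans (cong (tint x) (step-unique 1 i K
            (zone≤ (ℕₚ.<-≤-trans 0<m (ℕₚ.m≤m+n m d)) , inj₁ (trans end (sym (ℕₚ.+-identityʳ d)))))) (tint-upp x 0))
          where
          end : suc i ≡ d
          end = ℕₚ.≤-antisym i<d (ℕₚ.≮⇒≥ ¬p)

        next-upp : ∀ x {i k} → i < m + d → Step L 1 (d + i) k → Above₂ x i k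
        next-upp x {i} {k} i<m+d K with suc i ℕₚ.<? m + d
        ... | yes p = stay (trans (cong (tint x) (step-unique 1 (d + i) K (zone≤ p , inj₁ (sym (ℕₚ.+-suc d i)))))
            (tint-upp x (suc i)))
        ... | no ¬p = leave end (trans (cong (tint x) (step-unique 1 (d + i) K (ℕₚ.≤-trans 0<d (ℕₚ.m≤m+n d _) , inj₂
            (trans (sym (ℕₚ.+-suc d i)) (trans (cong (_+_ d) end) (sym (ℕₚ.+-identityʳ L))))))) (tint-low x 0<d))
          where
          end : suc i ≡ m + d
          end = ℕₚ.≤-antisym i<m+d (ℕₚ.≮⇒≥ ¬p)

        data Twisted (i l : ℕ) : Set where
          up   : i < m → tint 0 l ≡ upper 0 (d + i) → Twisted i l
          down : ∀ {i′} → i ≡ m + i′ → tint 0 l ≡ lower 0 i′ → Twisted i l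

        twist-low : ∀ {i l} → i < d → Step L d i l → tint 0 l ≡ upper 0 i
        twist-low {i} i<d M = trans (cong (tint 0) (step-unique d i M
            (zone≤ (ℕₚ.<-≤-trans i<d (ℕₚ.m≤n+m d m)) , inj₁ refl))) (tint-upp 0 _)

        twist-upp : ∀ {i l} → i < m + d → Step L d (d + i) l → Twisted i l
        twist-upp {i} i<m+d M with i ℕₚ.<? m
        ... | yes p = up p (trans (cong (tint 0) (step-unique d (d + i) M (zone≤ (subst (_< m + d) (ℕₚ.+-comm i d)
            (ℕₚ.+-monoˡ-< d p)) , inj₁ refl))) (tint-upp 0 _))
        ... | no ¬p = down (sym eq) (trans (cong (tint 0) (step-unique d (d + i) M (ℕₚ.<-≤-trans i′<d
            (ℕₚ.m≤m+n d _) , inj₂ wraps))) (tint-low 0 i′<d))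
          where
          i′ : ℕ
          i′ = i ∸ m
          eq : m + i′ ≡ i
          eq = ℕₚ.m+[n∸m]≡n (ℕₚ.≮⇒≥ ¬p)
          i′<d : i′ < d
          i′<d = ℕₚ.+-cancelˡ-< m _ _ (subst (_< m + d) (sym eq) i<m+d)
          wraps : d + (d + i) ≡ L + i′
          wraps = trans (cong (λ x → d + (d + x)) (sym eq)) (trans (cong (_+_ d) (trans (sym (ℕₚ.+-assoc d m i′))
              (cong (_+ i′) (ℕₚ.+-comm d m)))) (sym (ℕₚ.+-assoc d (m + d) i′)))

        ending₁ : ∀ {i} → suc i ≡ d → ends₁ i
        ending₁ refl = d≡k₁
        ending₂ : ∀ {i} → suc i ≡ m + d → ends₂ i
        ending₂ e = trans (cong (fold k₂) e) m+d≡k₂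

        inner : ∀ {x j k} → suc x < width g → Row j → Step L 1 j k →
                Compatible (tint x j) (tint (suc x) j) (tint x k)
        inner {x} x<h (low {i} p) K with inner-valid (column-classes-consecutive g x<h) i | next-low x p K
        ... | A , _ , _ , _ | stay e    = recolour (tint-low x p) (tint-low (suc x) p) e A
        ... | _ , B , _ , _ | leave f e = recolour (tint-low x p) (tint-low (suc x) p) e (B (ending₁ f))
        inner {x} x<h (upp {i} p) K with inner-valid (column-classes-consecutive g x<h) i | next-upp x p K
        ... | _ , _ , C , _ | stay e    = recolour (tint-upp x i) (tint-upp (suc x) i) e C
        ... | _ , _ , _ , D | leave f e = recolour (tint-upp x i) (tint-upp (suc x) i) e (D (ending₂ f))

        outer : ∀ {x j k l} → class x ≡ 2 → Row j → Step L 1 j k → Step L d j l →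
                Compatible (tint x j) (tint 0 l) (tint x k)
        outer {x} x≡2 (low {i} p) K M with lower-to-upper i | next-low x p K
        ... | A , _ | stay e    = recolour (trans (tint-low x p) (cong (λ c → lower c i) x≡2)) (twist-low p M)
            (trans e (cong (λ c → lower c (suc i)) x≡2)) A
        ... | _ , B | leave f e = recolour (trans (tint-low x p) (cong (λ c → lower c i) x≡2)) (twist-low p M)
            (trans e (cong (λ c → upper c 0) x≡2)) (B (ending₁ f))
        outer {x} x≡2 (upp {i} p) K M with twist-upp p M | next-upp x p K
        ... | up _ e | stay f = recolour (trans (tint-upp x i) (cong (λ c → upper c i) x≡2)) e
            (trans f (cong (λ c → upper c (suc i)) x≡2)) (upper-to-upper d i d≡k₁)
        ... | up i<m e | leave end f = contradiction (ℕₚ.+-mono-≤ i<m 0<d) (ℕₚ.<⇒≱ (subst (ℕ._< suc i + 1) end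
            (ℕₚ.m<m+n (suc i) (s≤s z≤n))))
        ... | down {i′} refl e | stay f = recolour (trans (tint-upp x i) (cong (λ c → upper c i) x≡2)) e
            (trans f (cong (λ c → upper c (suc i)) x≡2)) (proj₁ (upper-to-lower m i′ 0<m k₁+m≡k₂))
        ... | down {i′} refl e | leave end f = recolour (trans (tint-upp x i) (cong (λ c → upper c i) x≡2)) e
            (trans f (cong (λ c → lower c 0) x≡2))
               (proj₂ (upper-to-lower m i′ 0<m k₁+m≡k₂) (ending₁ (ℕₚ.+-cancelˡ-≡ m _ _ (trans (ℕₚ.+-suc m i′) end)))
                   (ending₂ end))

      torus : TwistedTorus (width g) L d
      torus = record
        { colour = tint
        ; inner  = λ x<h j<L K → inner x<h (row j<L) K
        ; outer  = λ {x} x≡h j<L K M → outer {x} (last-column-class g x≡h) (row j<L) K M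
        }

-- The tables and their finite checks

periodic-table-3-0 : Table
periodic-table-3-0 =
    (123 ∷  21 ∷ 320 ∷ [])
  ∷ (310 ∷ 413 ∷  14 ∷ [])
  ∷ ( 42 ∷ 340 ∷ 243 ∷ [])
  ∷ (423 ∷  24 ∷ 320 ∷ []) ∷ []

abstract
  periodic-valid-3-0 : Periodic.Valid 3 0 periodic-table-3-0
  periodic-valid-3-0 = from-yes (Periodic.valid? 3 0 periodic-table-3-0)

periodic-table-3-1 : Table
periodic-table-3-1 =
    (241 ∷  23 ∷ 140 ∷ [])
  ∷ (320 ∷ 143 ∷  21 ∷ [])
  ∷ (143 ∷  21 ∷ 430 ∷ [])
  ∷ ( 41 ∷ 320 ∷ 143 ∷ []) ∷ []

abstract
  periodic-valid-3-1 : Periodic.Valid 3 1 periodic-table-3-1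
  periodic-valid-3-1 = from-yes (Periodic.valid? 3 1 periodic-table-3-1)

periodic-table-3-2 : Table
periodic-table-3-2 =
    (143 ∷ 421 ∷ 320 ∷ [])
  ∷ (321 ∷  43 ∷ 140 ∷ [])
  ∷ (140 ∷ 321 ∷ 203 ∷ [])
  ∷ (140 ∷ 321 ∷  23 ∷ []) ∷ []

abstract
  periodic-valid-3-2 : Periodic.Valid 3 2 periodic-table-3-2
  periodic-valid-3-2 = from-yes (Periodic.valid? 3 2 periodic-table-3-2)

-- The tables of period 5 serve grids with exactly 5 rows, which are too short for the two zones
-- when d is 1 or 2.
periodic-table-5-1 : Table
periodic-table-5-1 =
    ( 43 ∷ 214 ∷ 301 ∷ 420 ∷ 132 ∷ [])
  ∷ (312 ∷ 403 ∷ 124 ∷  31 ∷ 240 ∷ [])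
  ∷ (403 ∷ 124 ∷  31 ∷ 240 ∷ 312 ∷ [])
  ∷ ( 43 ∷ 214 ∷ 301 ∷ 420 ∷ 132 ∷ []) ∷ []

abstract
  periodic-valid-5-1 : Periodic.Valid 5 1 periodic-table-5-1
  periodic-valid-5-1 = from-yes (Periodic.valid? 5 1 periodic-table-5-1)

periodic-table-5-2 : Table
periodic-table-5-2 =
    (241 ∷ 302 ∷  34 ∷ 210 ∷ 143 ∷ [])
  ∷ (123 ∷ 421 ∷ 204 ∷  32 ∷ 310 ∷ [])
  ∷ (410 ∷ 134 ∷ 321 ∷ 402 ∷  43 ∷ [])
  ∷ ( 41 ∷ 304 ∷ 132 ∷ 410 ∷ 243 ∷ []) ∷ []

abstract
  periodic-valid-5-2 : Periodic.Valid 5 2 periodic-table-5-2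
  periodic-valid-5-2 = from-yes (Periodic.valid? 5 2 periodic-table-5-2)

-- The name records k₁ and k₂: each class has k₁ + 3 lower rows followed by k₂ + 3 upper ones.
zones-table-3-4 : Table
zones-table-3-4 =
    (413 ∷ 214 ∷ 312 ∷ 413 ∷ 214 ∷ 312 ∷ 143 ∷ 401 ∷  34 ∷ 312 ∷ 413 ∷ 214 ∷ 312 ∷ [])
  ∷ ( 32 ∷ 430 ∷ 243 ∷  42 ∷ 340 ∷ 243 ∷  21 ∷ 342 ∷ 140 ∷ 234 ∷  32 ∷ 430 ∷ 234 ∷ [])
  ∷ (204 ∷ 120 ∷ 321 ∷ 203 ∷ 102 ∷ 301 ∷ 403 ∷ 201 ∷ 302 ∷ 401 ∷ 204 ∷ 102 ∷ 401 ∷ [])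
  ∷ (214 ∷  12 ∷ 310 ∷ 213 ∷  12 ∷ 310 ∷ 143 ∷ 201 ∷  32 ∷ 410 ∷ 214 ∷  12 ∷ 410 ∷ []) ∷ []

abstract
  zones-valid-3-4 : TwoZones.Valid 3 4 zones-table-3-4
  zones-valid-3-4 = from-yes (TwoZones.valid? 3 4 zones-table-3-4)

zones-table-1-6 : Table
zones-table-1-6 =
    (413 ∷ 214 ∷ 312 ∷ 413 ∷  12 ∷ 134 ∷ 312 ∷ 431 ∷ 234 ∷ 312 ∷ 413 ∷ 214 ∷ 312 ∷ [])
  ∷ (204 ∷ 320 ∷ 423 ∷  24 ∷ 320 ∷ 412 ∷  34 ∷ 210 ∷ 412 ∷  43 ∷ 240 ∷ 342 ∷  43 ∷ [])
  ∷ (341 ∷ 403 ∷ 104 ∷ 301 ∷ 403 ∷ 204 ∷ 102 ∷ 304 ∷ 203 ∷ 102 ∷ 301 ∷ 203 ∷ 102 ∷ [])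
  ∷ (413 ∷  14 ∷ 310 ∷ 413 ∷  14 ∷ 230 ∷ 412 ∷  34 ∷ 230 ∷ 312 ∷  13 ∷ 210 ∷ 312 ∷ []) ∷ []

abstract
  zones-valid-1-6 : TwoZones.Valid 1 6 zones-table-1-6
  zones-valid-1-6 = from-yes (TwoZones.valid? 1 6 zones-table-1-6)

zones-table-2-5 : Table
zones-table-2-5 =
    (412 ∷ 314 ∷ 213 ∷ 412 ∷ 314 ∷ 203 ∷  24 ∷ 231 ∷ 324 ∷ 213 ∷ 421 ∷ 324 ∷ 123 ∷ [])
  ∷ (324 ∷  23 ∷ 420 ∷ 324 ∷  23 ∷ 421 ∷ 340 ∷ 124 ∷  13 ∷ 420 ∷ 314 ∷  13 ∷ 410 ∷ [])
  ∷ (410 ∷ 314 ∷ 103 ∷ 401 ∷ 304 ∷ 103 ∷ 201 ∷ 403 ∷ 204 ∷ 103 ∷ 402 ∷ 304 ∷ 203 ∷ [])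
  ∷ (410 ∷ 314 ∷  13 ∷ 410 ∷ 314 ∷ 103 ∷  21 ∷ 430 ∷ 324 ∷  13 ∷ 420 ∷ 324 ∷  23 ∷ []) ∷ []

abstract
  zones-valid-2-5 : TwoZones.Valid 2 5 zones-table-2-5
  zones-valid-2-5 = from-yes (TwoZones.valid? 2 5 zones-table-2-5)

zones-table-3-5 : Table
zones-table-3-5 =
    (324 ∷ 213 ∷ 412 ∷ 134 ∷ 231 ∷ 432 ∷ 134 ∷ 230 ∷ 412 ∷ 143 ∷ 421 ∷ 324 ∷ 123 ∷ 421 ∷ [])
  ∷ ( 13 ∷ 402 ∷ 304 ∷ 210 ∷ 412 ∷  14 ∷ 210 ∷ 412 ∷  43 ∷ 210 ∷ 314 ∷  13 ∷ 410 ∷ 314 ∷ [])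
  ∷ (402 ∷ 314 ∷ 132 ∷ 304 ∷ 203 ∷ 402 ∷ 304 ∷ 203 ∷ 102 ∷ 304 ∷ 203 ∷ 402 ∷ 304 ∷ 203 ∷ [])
  ∷ (324 ∷ 213 ∷ 412 ∷  34 ∷ 230 ∷ 432 ∷  34 ∷ 230 ∷ 312 ∷  43 ∷ 420 ∷ 324 ∷  23 ∷ 420 ∷ []) ∷ []

abstract
  zones-valid-3-5 : TwoZones.Valid 3 5 zones-table-3-5
  zones-valid-3-5 = from-yes (TwoZones.valid? 3 5 zones-table-3-5)

zones-table-1-7 : Table
zones-table-1-7 =
    (241 ∷ 432 ∷ 134 ∷ 231 ∷ 402 ∷ 143 ∷ 214 ∷ 132 ∷ 431 ∷ 342 ∷ 143 ∷ 241 ∷ 342 ∷ 143 ∷ [])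
  ∷ (302 ∷ 140 ∷ 241 ∷  42 ∷ 143 ∷ 210 ∷ 342 ∷  41 ∷ 240 ∷ 123 ∷  21 ∷ 320 ∷ 123 ∷  21 ∷ [])
  ∷ (231 ∷ 302 ∷ 103 ∷ 201 ∷ 302 ∷ 403 ∷ 201 ∷ 302 ∷ 103 ∷ 401 ∷ 304 ∷ 103 ∷ 401 ∷ 304 ∷ [])
  ∷ (241 ∷  32 ∷ 130 ∷ 231 ∷ 302 ∷  43 ∷ 210 ∷ 132 ∷  31 ∷ 340 ∷ 143 ∷  41 ∷ 340 ∷ 143 ∷ []) ∷ []

abstract
  zones-valid-1-7 : TwoZones.Valid 1 7 zones-table-1-7
  zones-valid-1-7 = from-yes (TwoZones.valid? 1 7 zones-table-1-7)

zones-table-2-6 : Table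
zones-table-2-6 =
    (214 ∷ 321 ∷ 423 ∷ 124 ∷ 321 ∷ 204 ∷ 301 ∷ 423 ∷ 124 ∷ 321 ∷ 423 ∷ 124 ∷ 321 ∷ 423 ∷ [])
  ∷ (423 ∷  14 ∷ 310 ∷ 413 ∷  14 ∷ 321 ∷ 423 ∷ 140 ∷ 341 ∷  34 ∷ 130 ∷ 413 ∷  14 ∷ 310 ∷ [])
  ∷ (130 ∷ 423 ∷ 204 ∷ 302 ∷ 403 ∷ 104 ∷ 301 ∷ 203 ∷ 102 ∷ 401 ∷ 204 ∷ 302 ∷ 403 ∷ 204 ∷ [])
  ∷ (310 ∷ 423 ∷  24 ∷ 320 ∷ 423 ∷ 104 ∷ 301 ∷  23 ∷ 120 ∷ 421 ∷  24 ∷ 320 ∷ 423 ∷  24 ∷ []) ∷ []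

abstract
  zones-valid-2-6 : TwoZones.Valid 2 6 zones-table-2-6
  zones-valid-2-6 = from-yes (TwoZones.valid? 2 6 zones-table-2-6)

-- A Hamiltonian cycle with chords

-- A vertex on the cycle t ↦ t + 1: `source c` is left by a cycle edge of colour 2 and entered by one
-- of colour c, `target c` the other way round, and `plain c` is left by colour c and entered by the other of 0 and 1.
data Kind : Set where
  plain source target : Bool → Kind

kinds : List Kind
kinds = plain false ∷ plain true ∷ source false ∷ source true ∷ target false ∷ target true ∷ []

kind∈kinds : ∀ κ → κ ∈ kinds
kind∈kinds (plain false)  = here refl
kind∈kinds (plain true)   = there (here refl)
kind∈kinds (source false) = there (there (here refl))
kind∈kinds (source true)  = there (there (there (here refl)))
kind∈kinds (target false) = there (there (there (there (here refl))))
kind∈kinds (target true)  = there (there (there (there (there (here refl)))))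

bit : Bool → Fin 5
bit false = # 0
bit true  = # 1

-- Vertices of residue 0, 1, 2 and the edges opposite to them have colours 2, 3, 4, except that next to an
-- exceptional cycle edge (coloured 2) the colour 2 gives way to the colour missing there.
kind-cell : ℕ → Kind → Cell
kind-cell r (plain c)  = cell ((2 + r) mod 5) ((2 + (r + 2) % 3) mod 5) (bit c)
kind-cell 0 (source c) = cell (bit (not c)) (# 4) (# 2)
kind-cell 1 (source c) = cell (# 3) (bit (not c)) (# 2)
kind-cell _ (source c) = cell (# 4) (# 3) (# 2)
kind-cell 0 (target c) = cell (bit (not c)) (# 4) (bit c)
kind-cell 1 (target c) = cell (# 3) (bit (not c)) (bit c)
kind-cell _ (target c) = cell (# 4) (# 3) (bit c)

same : Bool → Bool → Bool
same false c = not c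
same true  c = c

same-refl : ∀ c → same c c ≡ true
same-refl false = refl
same-refl true  = refl

-- Both ends must agree on the colour of the cycle edge between them; recall that `plain c′` is
-- entered by the colour `not c′`.
follows : Kind → Kind → Bool
follows (plain c)  (plain c′)  = same c (not c′)
follows (plain c)  (source c′) = same c c′
follows (source _) (target _)  = true
follows (target c) (plain c′)  = same c (not c′)
follows (target c) (source c′) = same c c′
follows _          _           = false

-- If a chord of colour 2 meets an exceptional cycle edge at one end, the other end must be of the
-- same kind, so that both ends miss the colour that replaces 2 on the chord.
matches : Kind → Kind → Bool
matches (plain _)  (plain _)   = true
matches (source c) (source c′) = same c c′
matches (target c) (target c′) = same c c′
matches _          _           = false

-- The edge t, t + m has colour 2, if it is not changed, exactly when t has residue 1.
joinable : ℕ → Kind → Kind → Bool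
joinable 1 κ ζ = matches κ ζ
joinable _ _ _ = true

joinable-intro : ∀ r {κ ζ} → (r ≡ 1 → matches κ ζ ≡ true) → joinable r κ ζ ≡ true
joinable-intro zero          _ = refl
joinable-intro (suc zero)    p = p refl
joinable-intro (suc (suc _)) _ = refl

-- Here κ, κ′, ζ, ζ′ are the kinds of t, t + 1, t + m, t + m + 1. The fourth corner restricts the
-- other kinds through `follows` and `joinable`. Residues grow by σ along the cycle and by 1 along a
-- chord.
KindsCompatible : ℕ → Set
KindsCompatible σ = ∀ {r} → r < 3 → All (λ κ → All (λ κ′ → follows κ κ′ ≡ true → All (λ ζ → joinable r κ ζ ≡ true →
  All (λ ζ′ → follows ζ ζ′ ≡ true → joinable ((r + σ) % 3) κ′ ζ′ ≡ true →
    Compatible (kind-cell r κ) (kind-cell ((r + 1) % 3) ζ) (kind-cell ((r + σ) % 3) κ′)) kinds) kinds) kinds) kinds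

kinds-compatible? : ∀ σ → Dec (KindsCompatible σ)
kinds-compatible? σ = below? (λ r → All.all? (λ κ → All.all? (λ κ′ → (_ Boolₚ.≟ _) →-dec All.all?
    (λ ζ → (_ Boolₚ.≟ _) →-dec
  All.all? (λ ζ′ → (_ Boolₚ.≟ _) →-dec ((_ Boolₚ.≟ _) →-dec compatible? _ _ _)) kinds) kinds) kinds) kinds) 3

abstract
  kinds-compatible-1 : KindsCompatible 1
  kinds-compatible-1 = from-yes (kinds-compatible? 1)

  kinds-compatible-2 : KindsCompatible 2
  kinds-compatible-2 = from-yes (kinds-compatible? 2)

alternate : Bool → ℕ → Bool
alternate c zero    = c
alternate c (suc i) = not (alternate c i)

-- A stretch of the cycle starting with an exceptional edge: c is the colour before it, s the one after it.
stretch : Bool → Bool → ℕ → Kind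
stretch c s zero          = source c
stretch c s (suc zero)    = target s
stretch c s (suc (suc i)) = plain (alternate s (suc i))

same-not-not : ∀ c → same c (not (not c)) ≡ true
same-not-not false = refl
same-not-not true  = refl

stretch-follows : ∀ c s i → follows (stretch c s i) (stretch c s (suc i)) ≡ true
stretch-follows c s zero          = refl
stretch-follows c s (suc zero)    = same-not-not s
stretch-follows c s (suc (suc i)) = same-not-not (alternate s (suc i))

stretch-ends : ∀ c s i c′ s′ → alternate s i ≡ c′ → follows (stretch c s (suc i)) (stretch c′ s′ 0) ≡ true
stretch-ends c s zero    c′ s′ refl = same-refl s
stretch-ends c s (suc i) c′ s′ refl = same-refl (alternate s (suc i))

matches-plain : ∀ {c s c′ s′ i j} → 2 ≤ i → 2 ≤ j → matches (stretch c s i) (stretch c′ s′ j) ≡ true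
matches-plain (s≤s (s≤s _)) (s≤s (s≤s _)) = refl

alternate-involutive : ∀ c i → alternate (alternate c i) i ≡ c
alternate-involutive c zero    = refl
alternate-involutive c (suc i) = trans (cong not (trans (alternate-not (alternate c i) i)
    (cong not (alternate-involutive c i)))) (Boolₚ.not-involutive c)
  where
  alternate-not : ∀ c i → alternate (not c) i ≡ not (alternate c i)
  alternate-not c zero    = refl
  alternate-not c (suc i) = cong not (alternate-not c i)

step-% : ∀ L .{{_ : NonZero L}} d j {k} → Step L d j k → k ≡ (d + j) % L
step-% L d j {k} (k<L , inj₁ e) = trans (sym (m<n⇒m%n≡m k<L)) (cong (_% L) (sym e))
step-% L d j {k} (k<L , inj₂ e) = trans (sym (m<n⇒m%n≡m k<L)) (sym (trans (cong (_% L) (trans e (ℕₚ.+-comm L k)))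
    ([m+n]%n≡m%n k L)))

%-+ʳ : ∀ L .{{_ : NonZero L}} x y → (x + y % L) % L ≡ (x + y) % L
%-+ʳ L x y = trans (%-distribˡ-+ x (y % L) L) (trans (cong (λ z → (x % L + z) % L) (m%n%n≡m%n y L))
    (sym (%-distribˡ-+ x y L)))

%-+ˡ : ∀ L .{{_ : NonZero L}} x y → (x % L + y) % L ≡ (x + y) % L
%-+ˡ L x y = trans (cong (_% L) (ℕₚ.+-comm (x % L) y)) (trans (%-+ʳ L y x) (cong (_% L) (ℕₚ.+-comm y x)))

-- The line t ↦ t + 1 is cut at 0, m and 2m, where m = 2 + m′, into stretches of lengths m, m and 3 + 2e.
module Line (m′ e σ ε : ℕ) (valid : KindsCompatible σ) (s₀ s₁ s₂ : Bool) where

  m rest n : ℕ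
  m    = 2 + m′
  rest = 3 + e * 2
  n    = m + (m + rest)

  -- The residue of a vertex. The factor σ is chosen with σ m ≡ 1 modulo 3, and ε keeps residue 2
  -- away from the first exceptional edge.
  ρ : ℕ → ℕ
  ρ i = (σ * i + ε) % 3

  ρ-% : ∀ i → ρ (i % 3) ≡ ρ i
  ρ-% i = trans (%-distribˡ-+ (σ * (i % 3)) ε 3) (trans (cong (λ x → (x + ε % 3) % 3) times)
      (sym (%-distribˡ-+ (σ * i) ε 3)))
    where
    times : (σ * (i % 3)) % 3 ≡ (σ * i) % 3
    times = trans (%-distribˡ-* σ (i % 3) 3) (trans (cong (λ x → (σ % 3 * x) % 3) (m%n%n≡m%n i 3))
        (sym (%-distribˡ-* σ i 3)))

  ρ-shift : ∀ {μ} x i → x % 3 ≡ μ → ρ (x + i) ≡ ρ (μ + i)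
  ρ-shift x i refl = trans (sym (ρ-% (x + i))) (trans (cong ρ (sym (%-+ˡ 3 x i))) (ρ-% (x % 3 + i)))

  -- The colours with which the preceding stretches, in cyclic order, end.
  c₀ c₁ c₂ : Bool
  c₀ = alternate s₂ (suc (e * 2))
  c₁ = alternate s₀ m′
  c₂ = alternate s₁ m′

  module _
    (3∣n   : n % 3 ≡ 0)
    (σm≡1  : (σ * m) % 3 ≡ 1)
    -- A chord of colour 2 leads from residue 1 to residue 2. Between successive stretches its ends
    -- have to match; where it leaves the third stretch or enters the first one, it has to avoid the
    -- exceptional positions 0 and 1.
    (join₀ : ∀ i → ρ i ≡ 1 → matches (stretch c₀ s₀ i) (stretch c₁ s₁ i) ≡ true)
    (join₁ : ∀ i → ρ (m + i) ≡ 1 → matches (stretch c₁ s₁ i) (stretch c₂ s₂ i) ≡ true)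
    (big₀  : ∀ i → ρ i ≡ 2 → 2 ≤ i)
    (big₂  : ∀ i → ρ (m + (m + i)) ≡ 1 → 2 ≤ i)
    where

    private
      data Row : ℕ → Set where
        row₀ : ∀ {i} → i < m → Row i
        row₁ : ∀ {i} → i < m → Row (m + i)
        row₂ : ∀ {i} → i < rest → Row (m + (m + i))

      row : ∀ {j} → j < n → Row j
      row j<n with split m j<n
      ... | inj₁ p = row₀ p
      ... | inj₂ (i , refl , i<) with split m i<
      ...   | inj₁ p = row₁ p
      ...   | inj₂ (_ , refl , p) = row₂ p

      kind : ℕ → Kind
      kind = splice m (stretch c₀ s₀) (splice m (stretch c₁ s₁) (stretch c₂ s₂))

      kind₀ : ∀ {i} → i < m → kind i ≡ stretch c₀ s₀ i
      kind₀ = splice-< m {f = stretch c₀ s₀}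

      kind₁ : ∀ {i} → i < m → kind (m + i) ≡ stretch c₁ s₁ i
      kind₁ {i} i<m = trans (splice-+ m {f = stretch c₀ s₀} i) (splice-< m {f = stretch c₁ s₁} i<m)

      kind₂ : ∀ i → kind (m + (m + i)) ≡ stretch c₂ s₂ i
      kind₂ i = trans (splice-+ m {f = stretch c₀ s₀} (m + i)) (splice-+ m {f = stretch c₁ s₁} i)

      follows≡ : ∀ {κ κ′ ζ ζ′} → κ ≡ ζ → κ′ ≡ ζ′ → follows ζ ζ′ ≡ true → follows κ κ′ ≡ true
      follows≡ refl refl p = p

      joinable≡ : ∀ {r κ κ′ ζ ζ′} → κ ≡ ζ → κ′ ≡ ζ′ → (r ≡ 1 → matches ζ ζ′ ≡ true) → joinable r κ κ′ ≡ true
      joinable≡ {r} refl refl p = joinable-intro r p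

      0<m : 0 < m
      0<m = s≤s z≤n

      in₁ : ∀ {i} → i < m → m + i < n
      in₁ p = ℕₚ.+-monoʳ-< m (ℕₚ.<-≤-trans p (ℕₚ.m≤m+n m rest))
      in₂ : ∀ {i} → i < rest → m + (m + i) < n
      in₂ p = ℕₚ.+-monoʳ-< m (ℕₚ.+-monoʳ-< m p)

      moves : ∀ d j {k l} → Step n d j k → Step n d j l → kind k ≡ kind l
      moves d j p q = cong kind (step-unique d j p q)

      kind-follows : ∀ {j k} → Row j → Step n 1 j k → follows (kind j) (kind k) ≡ true
      kind-follows (row₀ {i} p) K with suc i ℕₚ.<? m
      ... | yes q = follows≡ (kind₀ p) (trans (moves 1 i K (ℕₚ.<-≤-trans q (ℕₚ.m≤m+n m _) , inj₁ refl)) (kind₀ q))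
                      (stretch-follows c₀ s₀ i)
      ... | no ¬q with ℕₚ.≤-antisym p (ℕₚ.≮⇒≥ ¬q)
      ...   | refl = follows≡ (kind₀ p) (trans (moves 1 i K (in₁ 0<m , inj₁ (sym (ℕₚ.+-identityʳ m)))) (kind₁ 0<m))
                      (stretch-ends c₀ s₀ m′ c₁ s₁ refl)
      kind-follows (row₁ {i} p) K with suc i ℕₚ.<? m
      ... | yes q = follows≡ (kind₁ p) (trans (moves 1 (m + i) K (in₁ q , inj₁ (sym (ℕₚ.+-suc m i)))) (kind₁ q))
                      (stretch-follows c₁ s₁ i)
      ... | no ¬q with ℕₚ.≤-antisym p (ℕₚ.≮⇒≥ ¬q)
      ...   | refl = follows≡ (kind₁ p) (trans (moves 1 (m + i) K (in₂ (s≤s z≤n) ,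
                        inj₁ (trans (sym (ℕₚ.+-suc m i)) (cong (_+_ m) (sym (ℕₚ.+-identityʳ m)))))) (kind₂ 0))
                      (stretch-ends c₁ s₁ m′ c₂ s₂ refl)
      kind-follows (row₂ {i} p) K with suc i ℕₚ.<? rest
      ... | yes q = follows≡ (kind₂ i) (trans (moves 1 (m + (m + i)) K (in₂ q ,
                        inj₁ (sym (trans (cong (_+_ m) (ℕₚ.+-suc m i)) (ℕₚ.+-suc m (m + i)))))) (kind₂ (suc i)))
                      (stretch-follows c₂ s₂ i)
      ... | no ¬q with ℕₚ.≤-antisym p (ℕₚ.≮⇒≥ ¬q)
      ...   | refl = follows≡ (kind₂ i) (trans (moves 1 (m + (m + i)) K (s≤s z≤n ,
                        inj₂ (trans (sym (trans (cong (_+_ m) (ℕₚ.+-suc m i)) (ℕₚ.+-suc m (m + i))))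
                            (sym (ℕₚ.+-identityʳ n))))) (kind₀ 0<m))
                      (stretch-ends c₂ s₂ (suc (e * 2)) c₀ s₀ refl)

      -- Wrapping subtracts n, which is divisible by 3, so residues are consistent around the cycle.
      ρ-step : ∀ d j {k} → Step n d j k → ρ k ≡ (ρ j + (σ * d) % 3) % 3
      ρ-step d j {k} K = trans (trans (sym (ρ-% k)) (trans (cong ρ (residue (proj₂ K))) (ρ-% (d + j))))
        (trans (cong (_% 3) shuffle) (trans (sym (%-+ʳ 3 (σ * j + ε) (σ * d))) (sym (%-+ˡ 3 (σ * j + ε) _))))
        where
        residue : d + j ≡ k ⊎ d + j ≡ n + k → k % 3 ≡ (d + j) % 3
        residue (inj₁ eq) = cong (_% 3) (sym eq)
        residue (inj₂ eq) = sym (trans (cong (_% 3) eq) (trans (%-distribˡ-+ n k 3)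
            (trans (cong (λ x → (x + k % 3) % 3) 3∣n) (m%n%n≡m%n k 3))))
        shuffle : σ * (d + j) + ε ≡ σ * j + ε + σ * d
        shuffle = trans (cong (λ x → x + ε) (trans (ℕₚ.*-distribˡ-+ σ d j) (ℕₚ.+-comm (σ * d) (σ * j))))
          (trans (ℕₚ.+-assoc (σ * j) (σ * d) ε) (trans (cong (_+_ (σ * j)) (ℕₚ.+-comm (σ * d) ε))
              (sym (ℕₚ.+-assoc (σ * j) ε (σ * d)))))

      ρ-step-1 : ∀ j {k} → Step n 1 j k → ρ k ≡ (ρ j + σ) % 3
      ρ-step-1 j K = trans (ρ-step 1 j K) (trans (%-+ʳ 3 (ρ j) (σ * 1)) (cong (λ x → (ρ j + x) % 3)
          (ℕₚ.*-identityʳ σ)))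

      ρ-step-m : ∀ j {k} → Step n m j k → ρ k ≡ (ρ j + 1) % 3
      ρ-step-m j K = trans (ρ-step m j K) (cong (λ x → (ρ j + x) % 3) σm≡1)

      after-1 : ∀ j {l} → Step n m j l → ρ j ≡ 1 → ρ l ≡ 2
      after-1 j M eq = trans (ρ-step-m j M) (cong (λ x → (x + 1) % 3) eq)

      -- From the first stretch to the second, and from the second to the third, a chord keeps the
      -- position within the stretch. Every other chord of colour 2 joins two plain vertices, by
      -- `big₀`, `big₂` and the bounds m ≥ 2 and `rest` ≥ 3.
      kind-joinable : ∀ {j l} → Row j → Step n m j l → joinable (ρ j) (kind j) (kind l) ≡ true
      kind-joinable (row₀ {i} p) M =
        joinable≡ (kind₀ p) (trans (moves m i M (in₁ p , inj₁ refl)) (kind₁ p)) (join₀ i)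
      kind-joinable (row₁ {i} p) M with i ℕₚ.<? rest
      ... | yes q = joinable≡ (kind₁ p) (trans (moves m (m + i) M (in₂ q , inj₁ refl)) (kind₂ i)) (join₁ i)
      ... | no ¬q = joinable≡ (kind₁ p) (trans (moves m (m + i) M M′) (kind₀ j<m))
              (λ eq → matches-plain {c₁} {s₁} {c₀} {s₀} (ℕₚ.≤-trans (s≤s (s≤s z≤n)) (ℕₚ.≮⇒≥ ¬q))
                  (big₀ j (after-1 (m + i) M′ eq)))
        where
        j : ℕ
        j = i ∸ rest
        rest+j : rest + j ≡ i
        rest+j = ℕₚ.m+[n∸m]≡n (ℕₚ.≮⇒≥ ¬q)
        j<m : j < m
        j<m = ℕₚ.≤-<-trans (ℕₚ.m∸n≤m i rest) p
        M′ : Step n m (m + i) j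
        M′ = ℕₚ.<-≤-trans j<m (ℕₚ.m≤m+n m _) , inj₂ (trans (cong (λ x → m + (m + x)) (sym rest+j))
               (trans (cong (_+_ m) (sym (ℕₚ.+-assoc m rest j))) (sym (ℕₚ.+-assoc m (m + rest) j))))
      kind-joinable (row₂ {i} p) M with m + i ℕₚ.<? rest
      ... | yes q = joinable≡ (kind₂ i) (trans (moves m (m + (m + i)) M (in₂ q , inj₁ refl)) (kind₂ (m + i)))
              (λ eq → matches-plain {c₂} {s₂} {c₂} {s₂} {j = m + i} (big₂ i eq) (s≤s (s≤s z≤n)))
      ... | no ¬q = joinable≡ (kind₂ i) (trans (moves m (m + (m + i)) M M′) (kind₀ j<m))
              (λ eq → matches-plain {c₂} {s₂} {c₀} {s₀} (big₂ i eq) (big₀ j (after-1 (m + (m + i)) M′ eq)))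
        where
        j : ℕ
        j = m + i ∸ rest
        rest+j : rest + j ≡ m + i
        rest+j = ℕₚ.m+[n∸m]≡n (ℕₚ.≮⇒≥ ¬q)
        j<m : j < m
        j<m = ℕₚ.+-cancelˡ-< rest _ _ (subst₂ _<_ (sym rest+j) (ℕₚ.+-comm m rest) (ℕₚ.+-monoʳ-< m p))
        M′ : Step n m (m + (m + i)) j
        M′ = ℕₚ.<-≤-trans j<m (ℕₚ.m≤m+n m _) , inj₂ (trans (cong (λ x → m + (m + x)) (sym rest+j))
               (trans (cong (_+_ m) (sym (ℕₚ.+-assoc m rest j))) (sym (ℕₚ.+-assoc m (m + rest) j))))

      tint : ℕ → Cell
      tint j = kind-cell (ρ j) (kind j)

      compatible-at : ∀ {j k l} → j < n → Step n 1 j k → Step n m j l → Compatible (tint j) (tint l) (tint k)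
      compatible-at {j} {k} {l} j<n K M =
        let l′ , N = step {n} {1} {l} (s≤s z≤n) (proj₁ M)
            M′ , M″ = step {n} {m} {k} (ℕₚ.m≤m+n m _) (proj₁ K)
            -- The corner l′, reached by the chord and then the cycle edge, is also reached by the
            -- cycle edge and then the chord.
            N′ = subst (Step n m k) (trans (step-% n m k M″) (trans (cong (λ x → (m + x) % n) (step-% n 1 j K))
                   (trans (%-+ʳ n m (suc j)) (trans (cong (_% n) (ℕₚ.+-suc m j)) (trans (sym (%-+ʳ n 1 (m + j)))
                   (trans (cong (λ x → suc x % n) (sym (step-% n m j M))) (sym (step-% n 1 l N)))))))) M″
        in recolour refl (cong (λ r → kind-cell r (kind l)) (ρ-step-m j M)) (cong (λ r → kind-cell r (kind k))
            (ρ-step-1 j K))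
             (All.lookup (All.lookup (All.lookup (All.lookup (valid (m%n<n (σ * j + ε) 3)) (kind∈kinds (kind j)))
                 (kind∈kinds (kind k))
               (kind-follows (row j<n) K)) (kind∈kinds (kind l))
               (kind-joinable (row j<n) M)) (kind∈kinds (kind l′))
               (kind-follows (row (proj₁ M)) N) (subst (λ r → joinable r (kind k) (kind l′) ≡ true) (ρ-step-1 j K)
                   (kind-joinable (row (proj₁ K)) N′)))

    torus : TwistedTorus 1 n m
    torus = record
      { colour = λ _ → tint
      ; inner  = λ { (s≤s ()) }
      ; outer  = λ _ → compatible-at
      }

-- For m ≡ 1 the critical chords join the targets of the first two exceptional edges and the sources
-- of the last two. Equal s₀, s₁, s₂ make both pairs match, since then c₁ = c₂.
line-torus₁ : ∀ m′ e → let m = 2 + m′ ; n = m + (m + (3 + e * 2)) in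
  n % 3 ≡ 0 → m % 3 ≡ 1 → TwistedTorus 1 n m
line-torus₁ m′ e 3∣n m≡1 = torus 3∣n (trans (cong (_% 3) (ℕₚ.+-identityʳ m)) m≡1) join₀ join₁ big₀ big₂
  where
  open Line m′ e 1 0 kinds-compatible-1 false false false
  join₀ : ∀ i → ρ i ≡ 1 → matches (stretch c₀ false i) (stretch c₁ false i) ≡ true
  join₀ zero          ()
  join₀ (suc zero)    _ = refl
  join₀ (suc (suc _)) _ = refl
  join₁ : ∀ i → ρ (m + i) ≡ 1 → matches (stretch c₁ false i) (stretch c₂ false i) ≡ true
  join₁ zero          _ = same-refl c₁
  join₁ (suc zero)    q with () ← trans (sym (ρ-shift m 1 m≡1)) q
  join₁ (suc (suc _)) _ = refl
  big₀ : ∀ i → ρ i ≡ 2 → 2 ≤ i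
  big₀ zero          ()
  big₀ (suc zero)    ()
  big₀ (suc (suc _)) _ = s≤s (s≤s z≤n)
  ρ₂ : ∀ i → ρ (m + (m + i)) ≡ ρ (2 + i)
  ρ₂ i = trans (ρ-shift m (m + i) m≡1) (trans (cong ρ (sym (ℕₚ.+-suc m i))) (ρ-shift m (suc i) m≡1))
  big₂ : ∀ i → ρ (m + (m + i)) ≡ 1 → 2 ≤ i
  big₂ zero          q with () ← trans (sym (ρ₂ 0)) q
  big₂ (suc zero)    q with () ← trans (sym (ρ₂ 1)) q
  big₂ (suc (suc _)) _ = s≤s (s≤s z≤n)

-- For m ≡ 2 it is the sources of the first two exceptional edges and the targets of the last two.
-- Hence s₁ = s₂; the odd length of the third stretch makes c₀ true, and s₀ is chosen so that c₁ is
-- true as well.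
line-torus₂ : ∀ m′ e → let m = 2 + m′ ; n = m + (m + (3 + e * 2)) in
  n % 3 ≡ 0 → m % 3 ≡ 2 → TwistedTorus 1 n m
line-torus₂ m′ e 3∣n m≡2 = torus 3∣n (trans (%-distribˡ-* 2 m 3) (cong (λ x → (2 * x) % 3) m≡2)) join₀ join₁ big₀ big₂
  where
  open Line m′ e 2 1 kinds-compatible-2 (alternate true m′) false false
  even : ∀ e → alternate false (suc (e * 2)) ≡ true
  even zero    = refl
  even (suc e) = cong (not ∘ not) (even e)
  join₀ : ∀ i → ρ i ≡ 1 → matches (stretch c₀ (alternate true m′) i) (stretch c₁ false i) ≡ true
  join₀ zero          _ = subst (λ c → same c c₁ ≡ true) (trans (alternate-involutive true m′) (sym (even e)))
      (same-refl c₁)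
  join₀ (suc zero)    ()
  join₀ (suc (suc _)) _ = refl
  join₁ : ∀ i → ρ (m + i) ≡ 1 → matches (stretch c₁ false i) (stretch c₂ false i) ≡ true
  join₁ zero          q with () ← trans (sym (ρ-shift m 0 m≡2)) q
  join₁ (suc zero)    _ = refl
  join₁ (suc (suc _)) _ = refl
  big₀ : ∀ i → ρ i ≡ 2 → 2 ≤ i
  big₀ zero          ()
  big₀ (suc zero)    ()
  big₀ (suc (suc _)) _ = s≤s (s≤s z≤n)
  ρ₂ : ∀ i → ρ (m + (m + i)) ≡ ρ (4 + i)
  ρ₂ i = trans (ρ-shift m (m + i) m≡2) (trans (cong ρ (trans (cong suc (sym (ℕₚ.+-suc m i)))
      (sym (ℕₚ.+-suc m (suc i))))) (ρ-shift m (2 + i) m≡2))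
  big₂ : ∀ i → ρ (m + (m + i)) ≡ 1 → 2 ≤ i
  big₂ zero          q with () ← trans (sym (ρ₂ 0)) q
  big₂ (suc zero)    q with () ← trans (sym (ρ₂ 1)) q
  big₂ (suc (suc _)) _ = s≤s (s≤s z≤n)

-- Tori for all admissible twists

odd : ∀ {n} → n % 2 ≡ 1 → ∃ λ k → n ≡ 1 + k * 2
odd {n} p = n / 2 , trans (m≡m%n+[m/n]*n n 2) (cong (_+ n / 2 * 2) p)

below-3 : ∀ {r} → r < 3 → r ≡ 0 ⊎ r ≡ 1 ⊎ r ≡ 2
below-3 {zero}              _ = inj₁ refl
below-3 {suc zero}          _ = inj₂ (inj₁ refl)
below-3 {suc (suc zero)}    _ = inj₂ (inj₂ refl)
below-3 {suc (suc (suc _))} (s≤s (s≤s (s≤s ())))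

residue-3 : ∀ x → x % 3 ≡ 0 ⊎ x % 3 ≡ 1 ⊎ x % 3 ≡ 2
residue-3 x = below-3 (m%n<n x 3)

odd-sum : ∀ d x → (d + (d + x)) % 2 ≡ x % 2
odd-sum d x = trans (cong (_% 2) (trans (sym (ℕₚ.+-assoc d d x)) (trans (ℕₚ.+-comm (d + d) x)
    (cong (_+_ x) double)))) ([m+kn]%n≡m%n x d 2)
  where
  double : d + d ≡ d * 2
  double = trans (cong (_+_ d) (sym (ℕₚ.+-identityʳ d))) (ℕₚ.*-comm 2 d)

-- As n is odd, n - 2 m is odd, and it exceeds 1, so it is the length 3 + 2 e of a third stretch.
line-torus : ∀ {n m} → n % 3 ≡ 0 → n % 2 ≡ 1 → m % 3 ≢ 0 → 1 < m → suc (m + m) < n → TwistedTorus 1 n m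
line-torus {n} {m@(suc (suc m′))} 3∣n n-odd 3∤m (s≤s (s≤s z≤n)) 2m+1<n with odd rest-odd
  where
  rest-odd : (n ∸ (m + m)) % 2 ≡ 1
  rest-odd = trans (sym (odd-sum m _)) (trans (cong (_% 2) (trans (sym (ℕₚ.+-assoc m m _)) (ℕₚ.m+[n∸m]≡n
      (ℕₚ.<⇒≤ (ℕₚ.<-trans (ℕₚ.n<1+n _) 2m+1<n))))) n-odd)
... | zero , eq = contradiction 2m+1<n
    (ℕₚ.≤⇒≯ (ℕₚ.≤-reflexive (trans (sym (ℕₚ.m+[n∸m]≡n (ℕₚ.<⇒≤ (ℕₚ.<-trans (ℕₚ.n<1+n _) 2m+1<n))))
    (trans (cong (_+_ (m + m)) eq) (ℕₚ.+-comm (m + m) 1)))))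
... | suc e , eq = subst (λ n → TwistedTorus 1 n m) (sym n≡) (choose (residue-3 m))
  where
  n≡ : n ≡ m + (m + (3 + e * 2))
  n≡ = trans (sym (ℕₚ.m+[n∸m]≡n (ℕₚ.<⇒≤ (ℕₚ.<-trans (ℕₚ.n<1+n _) 2m+1<n)))) (trans (cong (_+_ (m + m)) eq)
      (ℕₚ.+-assoc m m _))
  choose : m % 3 ≡ 0 ⊎ m % 3 ≡ 1 ⊎ m % 3 ≡ 2 → TwistedTorus 1 (m + (m + (3 + e * 2))) m
  choose (inj₁ m≡0)        = contradiction m≡0 3∤m
  choose (inj₂ (inj₁ m≡1)) = line-torus₁ m′ e (trans (cong (_% 3) (sym n≡)) 3∣n) m≡1
  choose (inj₂ (inj₂ m≡2)) = line-torus₂ m′ e (trans (cong (_% 3) (sym n≡)) 3∣n) m≡2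

periodic-torus : ∀ g q d → TwistedTorus (width g) (q * 3) d
periodic-torus g q d with residue-3 d
... | inj₁ d≡0        = Periodic.torus 3 0 periodic-table-3-0 periodic-valid-3-0 g q d d≡0
... | inj₂ (inj₁ d≡1) = Periodic.torus 3 1 periodic-table-3-1 periodic-valid-3-1 g q d d≡1
... | inj₂ (inj₂ d≡2) = Periodic.torus 3 2 periodic-table-3-2 periodic-valid-3-2 g q d d≡2

fold-exact : ∀ {k d} → k ≤ d → d % 3 ≡ k % 3 → fold k d ≡ k
fold-exact {k} {d} k≤d d≡k = trans (cong (fold k) (sym eq)) (trans (fold-+ k (d ∸ k))
    (trans (cong (_+_ k) zero-residue) (ℕₚ.+-identityʳ k)))
  where
  eq : k + (d ∸ k) ≡ d
  eq = ℕₚ.m+[n∸m]≡n k≤d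
  fold-+ : ∀ k i → fold k (k + i) ≡ k + fold 0 i
  fold-+ zero    i = refl
  fold-+ (suc k) i = cong suc (fold-+ k i)
  cancel : ∀ {r s} → r ≡ 0 ⊎ r ≡ 1 ⊎ r ≡ 2 → s ≡ 0 ⊎ s ≡ 1 ⊎ s ≡ 2 → (r + s) % 3 ≡ r → s ≡ 0
  cancel _                  (inj₁ s≡0)         _ = s≡0
  cancel (inj₁ refl)        (inj₂ (inj₁ refl)) ()
  cancel (inj₁ refl)        (inj₂ (inj₂ refl)) ()
  cancel (inj₂ (inj₁ refl)) (inj₂ (inj₁ refl)) ()
  cancel (inj₂ (inj₁ refl)) (inj₂ (inj₂ refl)) ()
  cancel (inj₂ (inj₂ refl)) (inj₂ (inj₁ refl)) ()
  cancel (inj₂ (inj₂ refl)) (inj₂ (inj₂ refl)) ()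
  zero-residue : fold 0 (d ∸ k) ≡ 0
  zero-residue = trans (fold-residue (d ∸ k)) (cancel (residue-3 k) (residue-3 (d ∸ k))
    (trans (sym (%-distribˡ-+ k (d ∸ k) 3)) (trans (cong (_% 3) eq) d≡k)))

-- The residues of d and m determine k₁ and k₂ modulo 3; the values chosen fail only for 5 rows.
two-zone-torus : ∀ g {d m} → 0 < d → 0 < m → m % 2 ≡ 1 → (m + (d + d)) % 3 ≢ 0 →
  TwistedTorus (width g) (d + (m + d)) d
two-zone-torus g {d} {m} 0<d 0<m m-odd 3∤L = choose (residue-3 d) (residue-3 m)
  where
  Goal : Set
  Goal = TwistedTorus (width g) (d + (m + d)) d

  zones : ∀ {δ μ} k₁ k₂ T → TwoZones.Valid k₁ k₂ T → d % 3 ≡ δ → m % 3 ≡ μ → k₁ % 3 ≡ δ → k₂ % 3 ≡ (μ + δ) % 3 →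
          k₁ ≤ d → k₂ ≤ m + d → Goal
  zones {δ} {μ} k₁ k₂ T V d≡δ m≡μ k₁≡δ k₂≡ k₁≤d k₂≤m+d = TwoZones.torus k₁ k₂ T V g
    (fold-exact k₁≤d (trans d≡δ (sym k₁≡δ)))
    (fold-exact k₂≤m+d (trans (trans (%-distribˡ-+ m d 3) (cong₂ (λ x y → (x + y) % 3) m≡μ d≡δ)) (sym k₂≡)))
    0<m
    (trans (trans (%-distribˡ-+ k₁ m 3) (trans (cong₂ (λ x y → (x + y) % 3) k₁≡δ m≡μ)
        (cong (_% 3) (ℕₚ.+-comm δ μ)))) (sym k₂≡))

  -- It is applied when d ≡ m modulo 3, exactly the case in which 3 divides m + 2 d.
  excluded : ∀ {δ μ} → d % 3 ≡ δ → m % 3 ≡ μ → (μ + (δ + δ) % 3) % 3 ≢ 0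
  excluded refl refl e = 3∤L (trans (%-distribˡ-+ m (d + d) 3) (trans (cong (λ x → (m % 3 + x) % 3)
      (%-distribˡ-+ d d 3)) e))

  at-least-3 : ∀ {x} → 0 < x → x % 3 ≡ 0 → 3 ≤ x
  at-least-3 {suc zero}             _ ()
  at-least-3 {suc (suc zero)}       _ ()
  at-least-3 {suc (suc (suc _))}    _ _ = s≤s (s≤s (s≤s z≤n))

  at-least-2 : ∀ {x} → x % 3 ≡ 2 → 2 ≤ x
  at-least-2 {suc (suc _)} _ = s≤s (s≤s z≤n)
  at-least-2 {zero}     ()
  at-least-2 {suc zero} ()

  -- Oddness rules out 2, which would leave too few rows for k₂ = 6.
  at-least-5 : ∀ {x} → x % 2 ≡ 1 → x % 3 ≡ 2 → 5 ≤ x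
  at-least-5 {suc (suc (suc (suc (suc _))))} _ _ = s≤s (s≤s (s≤s (s≤s (s≤s z≤n))))
  at-least-5 {zero}                ()
  at-least-5 {suc zero}            _ ()
  at-least-5 {suc (suc zero)}      ()
  at-least-5 {suc (suc (suc zero))} _ ()
  at-least-5 {suc (suc (suc (suc zero)))} ()

  1-or-at-least-4 : ∀ {x} → x % 3 ≡ 1 → x ≡ 1 ⊎ 4 ≤ x
  1-or-at-least-4 {suc zero} _ = inj₁ refl
  1-or-at-least-4 {suc (suc (suc (suc _)))} _ = inj₂ (s≤s (s≤s (s≤s (s≤s z≤n))))
  1-or-at-least-4 {zero}                 ()
  1-or-at-least-4 {suc (suc zero)}       ()
  1-or-at-least-4 {suc (suc (suc zero))} ()

  2-or-at-least-5 : ∀ {x} → x % 3 ≡ 2 → x ≡ 2 ⊎ 5 ≤ x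
  2-or-at-least-5 {suc (suc zero)} _ = inj₁ refl
  2-or-at-least-5 {suc (suc (suc (suc (suc _))))} _ = inj₂ (s≤s (s≤s (s≤s (s≤s (s≤s z≤n)))))
  2-or-at-least-5 {zero}                       ()
  2-or-at-least-5 {suc zero}                   ()
  2-or-at-least-5 {suc (suc (suc zero))}       ()
  2-or-at-least-5 {suc (suc (suc (suc zero)))} ()

  3-or-at-least-6 : ∀ {x} → 0 < x → x % 3 ≡ 0 → x ≡ 3 ⊎ 6 ≤ x
  3-or-at-least-6 {suc (suc (suc zero))} _ _ = inj₁ refl
  3-or-at-least-6 {suc (suc (suc (suc (suc (suc _)))))} _ _ = inj₂ (s≤s (s≤s (s≤s (s≤s (s≤s (s≤s z≤n))))))
  3-or-at-least-6 {suc zero}                         _ ()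
  3-or-at-least-6 {suc (suc zero)}                   _ ()
  3-or-at-least-6 {suc (suc (suc (suc zero)))}       _ ()
  3-or-at-least-6 {suc (suc (suc (suc (suc zero))))} _ ()

  case-1-0 : d % 3 ≡ 1 → m % 3 ≡ 0 → (d ≡ 1 × m ≡ 3) ⊎ 7 ≤ m + d
  case-1-0 δ μ with 1-or-at-least-4 δ | 3-or-at-least-6 0<m μ
  ... | inj₁ p | inj₁ q = inj₁ (p , q)
  ... | _      | inj₂ q = inj₂ (ℕₚ.+-mono-≤ q 0<d)
  ... | inj₂ p | inj₁ q = inj₂ (ℕₚ.+-mono-≤ (ℕₚ.≤-reflexive (sym q)) p)

  case-2-1 : d % 3 ≡ 2 → m % 3 ≡ 1 → (d ≡ 2 × m ≡ 1) ⊎ 6 ≤ m + d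
  case-2-1 δ μ with 2-or-at-least-5 δ | 1-or-at-least-4 μ
  ... | inj₁ p | inj₁ q = inj₁ (p , q)
  ... | inj₂ p | _      = inj₂ (ℕₚ.+-mono-≤ 0<m p)
  ... | inj₁ p | inj₂ q = inj₂ (ℕₚ.+-mono-≤ q (ℕₚ.≤-reflexive (sym p)))

  choose : d % 3 ≡ 0 ⊎ d % 3 ≡ 1 ⊎ d % 3 ≡ 2 → m % 3 ≡ 0 ⊎ m % 3 ≡ 1 ⊎ m % 3 ≡ 2 → Goal
  choose (inj₁ δ)        (inj₁ μ)        = contradiction refl (excluded δ μ)
  choose (inj₁ δ)        (inj₂ (inj₁ μ)) = zones 3 4 zones-table-3-4 zones-valid-3-4 δ μ refl refl
    (at-least-3 0<d δ) (ℕₚ.+-mono-≤ 0<m (at-least-3 0<d δ))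
  choose (inj₁ δ)        (inj₂ (inj₂ μ)) = zones 3 5 zones-table-3-5 zones-valid-3-5 δ μ refl refl
    (at-least-3 0<d δ) (ℕₚ.+-mono-≤ (at-least-2 μ) (at-least-3 0<d δ))
  choose (inj₂ (inj₁ δ)) (inj₁ μ)        with case-1-0 δ μ
  ... | inj₂ p             = zones 1 7 zones-table-1-7 zones-valid-1-7 δ μ refl refl 0<d p
  -- Here m + d = 4 is less than k₂ = 7; the 5 rows are one period of a separate table.
  ... | inj₁ (refl , refl) = Periodic.torus 5 1 periodic-table-5-1 periodic-valid-5-1 g 1 1 refl
  choose (inj₂ (inj₁ δ)) (inj₂ (inj₁ μ)) = contradiction refl (excluded δ μ)
  choose (inj₂ (inj₁ δ)) (inj₂ (inj₂ μ)) = zones 1 6 zones-table-1-6 zones-valid-1-6 δ μ refl refl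
    0<d (ℕₚ.+-mono-≤ (at-least-5 m-odd μ) 0<d)
  choose (inj₂ (inj₂ δ)) (inj₁ μ)        = zones 2 5 zones-table-2-5 zones-valid-2-5 δ μ refl refl
    (at-least-2 δ) (ℕₚ.+-mono-≤ (at-least-3 0<m μ) (at-least-2 δ))
  choose (inj₂ (inj₂ δ)) (inj₂ (inj₁ μ)) with case-2-1 δ μ
  ... | inj₂ p             = zones 2 6 zones-table-2-6 zones-valid-2-6 δ μ refl refl (at-least-2 δ) p
  ... | inj₁ (refl , refl) = Periodic.torus 5 2 periodic-table-5-2 periodic-valid-5-2 g 1 2 refl
  choose (inj₂ (inj₂ δ)) (inj₂ (inj₂ μ)) = contradiction refl (excluded δ μ)

-- Torus coordinates from Bézout's identity

private
  lift : ∀ g x m y n → g + y * n ≡ x * m → + x ℤ.* + m ≡ + g ℤ.+ + y ℤ.* + n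
  lift g x m y n eq = trans (sym (ℤₚ.pos-* x m)) (trans (cong +_ (sym eq)) (cong (λ z → + g ℤ.+ z) (ℤₚ.pos-* y n)))

abstract
  bézout : ∀ m n → ∃₂ λ u v → u ℤ.* + m ℤ.+ v ℤ.* + n ≡ + gcd m n
  bézout m n with Bézout.identity (gcd-GCD m n)
  ... | Bézout.+- x y eq =
    + x , - + y , trans (cong (λ s → s ℤ.+ - + y ℤ.* + n) (lift (gcd m n) x m y n eq)) (cancel (+ gcd m n) (+ y)
        (+ n))
    where
    cancel : ∀ g y n → g ℤ.+ y ℤ.* n ℤ.+ - y ℤ.* n ≡ g
    cancel = solve-∀
  ... | Bézout.-+ x y eq =
    - + x , + y , trans (cong (λ s → - + x ℤ.* + m ℤ.+ s) (lift (gcd m n) y n x m eq)) (cancel (+ gcd m n) (+ x)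
        (+ m))
    where
    cancel : ∀ g x m → - x ℤ.* m ℤ.+ (g ℤ.+ x ℤ.* m) ≡ g
    cancel = solve-∀

-- Modulo n the multiples of b form h cosets, cycles of length L, which the step a permutes cyclically.
module Presentation {n a b h L : ℕ} .{{_ : NonZero h}} .{{_ : NonZero L}}
  (coprime : gcd a b ≡ 1) (gcd≡h : gcd n b ≡ h) (hL≡n : h * L ≡ n) where

  -- The multiple h a lies in ⟨b⟩; d is its position there, counted along b or along -b.
  Turn⁻ Turn⁺ : ℕ → Set
  Turn⁻ d = + n ∣ + h ℤ.* + a - + d ℤ.* + b
  Turn⁺ d = + n ∣ + h ℤ.* + a ℤ.+ + d ℤ.* + b

  private
    u v w z : ℤ
    u = proj₁ (bézout a b)
    v = proj₁ (proj₂ (bézout a b))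
    z = proj₁ (bézout n b)
    w = proj₁ (proj₂ (bézout n b))

    ua+vb≡1 : u ℤ.* + a ℤ.+ v ℤ.* + b ≡ + 1
    ua+vb≡1 = trans (proj₂ (proj₂ (bézout a b))) (cong +_ coprime)

    wb-h : w ℤ.* + b - + h ≡ - z ℤ.* + n
    wb-h = trans (cong (λ x → w ℤ.* + b - x) (sym (trans (proj₂ (proj₂ (bézout n b))) (cong +_ gcd≡h))))
        (lemma (+ n) (+ b) w z)
      where
      lemma : ∀ n b w z → w ℤ.* b - (z ℤ.* n ℤ.+ w ℤ.* b) ≡ - z ℤ.* n
      lemma = solve-∀

    h∣b : ℤ.+ h ∣ + b
    h∣b = ∣ᵤ⇒∣ (subst (ℕ∣._∣ b) gcd≡h (gcd[m,n]∣n n b))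

    n∣Lb : ℤ.+ n ∣ + L ℤ.* + b
    n∣Lb = subst₂ _∣_ (cong +_ hL≡n) (ℤₚ.pos-* L b) (∣ᵤ⇒∣ (subst (ℕ∣._∣ (L * b)) (ℕₚ.*-comm L h) (ℕ∣.*-monoʳ-∣ L
        (subst (ℕ∣._∣ b) gcd≡h (gcd[m,n]∣n n b)))))

  pattern⁻ : ∀ {d} → d ≤ L → Turn⁻ d → TwistedTorus h L d → Pattern n (+ a) (+ b)
  pattern⁻ {d} d≤L turn T = subst (λ n → Pattern n (+ a) (+ b)) hL≡n
    (torus⇒pattern {u = u} {v} {w}
      (divides (+ 0) (cong (_- + 1) ua+vb≡1))
      (subst (λ n → + n ∣ w ℤ.* + b - + h) (sym hL≡n) (divides (- z) wb-h))
      h∣b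
      (subst (λ n → + n ∣ + h ℤ.* + a - + d ℤ.* + b) (sym hL≡n) turn) d≤L T)

  -- A twist counted along -b is an ordinary twist for the pair a, -b, with v and w negated;
  -- `pattern-reverse` then restores b.
  pattern⁺ : ∀ {d} → d ≤ L → Turn⁺ d → TwistedTorus h L d → Pattern n (+ a) (+ b)
  pattern⁺ {d} d≤L turn T = pattern-reverse (subst (λ n → Pattern n (+ a) (- + b)) hL≡n
    (torus⇒pattern {u = u} { - v} { - w}
      (divides (+ 0) (trans (negate₂ u v (+ a) (+ b)) (cong (_- + 1) ua+vb≡1)))
      (subst (λ n → + n ∣ - w ℤ.* - + b - + h) (sym hL≡n) (divides (- z) (trans (negate₁ w (+ b) (+ h)) wb-h)))
      (∣m⇒∣-m h∣b)
      (subst₂ _∣_ (cong +_ (sym hL≡n)) (negate₀ (+ h) (+ a) (+ d) (+ b)) turn) d≤L T))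
    where
    negate₂ : ∀ u v a b → u ℤ.* a ℤ.+ - v ℤ.* - b - + 1 ≡ u ℤ.* a ℤ.+ v ℤ.* b - + 1
    negate₂ = solve-∀
    negate₁ : ∀ w b h → - w ℤ.* - b - h ≡ w ℤ.* b - h
    negate₁ = solve-∀
    negate₀ : ∀ h a d b → h ℤ.* a ℤ.+ d ℤ.* b ≡ h ℤ.* a - d ℤ.* - b
    negate₀ = solve-∀

  pattern± : ∀ {d} → d ≤ L → Turn⁻ d ⊎ Turn⁺ d → TwistedTorus h L d → Pattern n (+ a) (+ b)
  pattern± d≤L = [ pattern⁻ d≤L , pattern⁺ d≤L ]′

  private
    d₀ : ℕ
    d₀ = (w ℤ.* + a) %ℕ L

    -- From w b ≡ h follows h a ≡ (w a) b, and the coefficient of b matters modulo L only.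
    turn₀ : Turn⁻ d₀
    turn₀ = subst (+ n ∣_) (sym (trans (cong (λ x → + h ℤ.* + a - x ℤ.* + b) d₀≡) (expand (+ h) (+ a) (+ b) w q
        (+ L))))
      (∣m∣n⇒∣m-n (∣n⇒∣m*n q n∣Lb) (∣m⇒∣m*n (+ a) (divides (- z) wb-h)))
      where
      q : ℤ
      q = (w ℤ.* + a) /ℕ L
      isolate : ∀ {x y z} → x ≡ y ℤ.+ z → y ≡ x - z
      isolate {y = y} {z} refl = lemma y z
        where
        lemma : ∀ y z → y ≡ y ℤ.+ z - z
        lemma = solve-∀
      d₀≡ : ℤ.+ d₀ ≡ w ℤ.* + a - q ℤ.* + L
      d₀≡ = isolate (a≡a%ℕn+[a/ℕn]*n (w ℤ.* + a) L)
      expand : ∀ h a b w q L → h ℤ.* a - (w ℤ.* a - q ℤ.* L) ℤ.* b ≡ q ℤ.* (L ℤ.* b) - (w ℤ.* b - h) ℤ.* a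
      expand = solve-∀

  -- One of d₀ and L - d₀ is below L / 2, equality being excluded by hypothesis. Since n ∣ L b, the
  -- second one counts the twist along -b.
  turning-number : (∀ d → d + d ≢ L) → ∃ λ d → d + d < L × (Turn⁻ d ⊎ Turn⁺ d)
  turning-number odd with d₀ + d₀ ℕₚ.<? L
  ... | yes p = d₀ , p , inj₁ turn₀
  ... | no ¬p = e , e+e<L , inj₂ (subst (+ n ∣_) (trans (complement (+ h) (+ a) (+ b) (+ d₀) (+ L))
      (cong (λ x → + h ℤ.* + a ℤ.+ x ℤ.* + b) L-d₀≡e)) (∣m∣n⇒∣m+n turn₀ n∣Lb))
    where
    e : ℕ
    e = L ∸ d₀
    d₀+e≡L : d₀ + e ≡ L
    d₀+e≡L = ℕₚ.m+[n∸m]≡n (ℕₚ.<⇒≤ (n%ℕd<d (w ℤ.* + a) L))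
    e<d₀ : e < d₀
    e<d₀ = ℕₚ.+-cancelˡ-< d₀ _ _ (subst (_< d₀ + d₀) (sym d₀+e≡L) (ℕₚ.≤∧≢⇒< (ℕₚ.≮⇒≥ ¬p) (≢-sym (odd d₀))))
    e+e<L : e + e < L
    e+e<L = subst (e + e <_) d₀+e≡L (ℕₚ.+-monoˡ-< e e<d₀)
    L-d₀≡e : ℤ.+ L - + d₀ ≡ + e
    L-d₀≡e = trans (cong (λ x → + x - + d₀) (sym d₀+e≡L)) (lemma (+ d₀) (+ e))
      where
      lemma : ∀ d e → d ℤ.+ e - d ≡ e
      lemma = solve-∀
    complement : ∀ h a b d L → h ℤ.* a - d ℤ.* b ℤ.+ L ℤ.* b ≡ h ℤ.* a ℤ.+ (L - d) ℤ.* b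
    complement = solve-∀

-- The case distinction

odd-factorˡ : ∀ x y → (x * y) % 2 ≡ 1 → x % 2 ≡ 1
odd-factorˡ x y p with x % 2 | m%n<n x 2 | trans (sym (%-distribˡ-* x y 2)) p
... | zero        | _ | ()
... | suc zero    | _ | _ = refl
... | suc (suc _) | s≤s (s≤s ()) | _

odd⇒≢double : ∀ {x} → x % 2 ≡ 1 → ∀ d → d + d ≢ x
odd⇒≢double p d refl with () ← trans (sym p) (trans (cong (λ x → (d + x) % 2) (sym (ℕₚ.+-identityʳ d))) (odd-sum d 0))

module _ {n a b : ℕ} (n-odd : n % 2 ≡ 1) where
  instance
    n≢0 : NonZero n
    n≢0 = ℕ.≢-nonZero λ { refl → contradiction n-odd λ () }

  module _ (coprime : gcd a b ≡ 1) where

    long-cycles : ∀ g L → width g * (L * 3) ≡ n → gcd n b ≡ width g → Pattern n (+ a) (+ b)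
    long-cycles g zero eq _ = contradiction (trans (sym eq) (ℕₚ.*-zeroʳ (width g))) (ℕ.≢-nonZero⁻¹ n)
    long-cycles g L@(suc _) eq gcd≡h =
      let open Presentation {a = a} {b = b} {h = width g} {L = L * 3} coprime gcd≡h eq
          d , 2d<L , turn = turning-number (odd⇒≢double (odd-factorˡ (L * 3) (width g)
              (trans (cong (_% 2) (trans (ℕₚ.*-comm (L * 3) (width g)) eq)) n-odd)))
      in pattern± (ℕₚ.<⇒≤ (ℕₚ.≤-<-trans (ℕₚ.m≤m+n d d) 2d<L)) turn (periodic-torus g L d)

    short-cycles : 0 < b → b < n → ∀ g L → width g * L ≡ n → gcd n b ≡ width g → gcd n a ≡ 1 → L % 3 ≢ 0 → Pattern n
        (+ a) (+ b)
    short-cycles _ _ g zero eq _ _ _ = contradiction (trans (sym eq) (ℕₚ.*-zeroʳ (width g))) (ℕ.≢-nonZero⁻¹ n)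
    short-cycles 0<b b<n g L@(suc _) eq gcd≡h a-unit 3∤L = pattern± (ℕₚ.<⇒≤ (ℕₚ.≤-<-trans (ℕₚ.m≤m+n d d) 2d<L)) turn
        (subst (λ L → TwistedTorus (width g) L d) (trans (cong (_+_ d) (ℕₚ.+-comm m d)) d+d+m≡L)
          (two-zone-torus g 0<d 0<m m-odd
              (λ e → 3∤L (trans (cong (_% 3) (sym (trans (ℕₚ.+-comm m (d + d))
              (trans (ℕₚ.+-assoc d d m) d+d+m≡L)))) e))))
      where
      open Presentation {a = a} {b = b} {h = width g} {L = L} coprime gcd≡h eq
      L-odd : L % 2 ≡ 1
      L-odd = odd-factorˡ L (width g) (trans (cong (_% 2) (trans (ℕₚ.*-comm L (width g)) eq)) n-odd)
      T = turning-number (odd⇒≢double L-odd)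
      d : ℕ
      d = proj₁ T
      2d<L : d + d < L
      2d<L = proj₁ (proj₂ T)
      turn : Turn⁻ d ⊎ Turn⁺ d
      turn = proj₂ (proj₂ T)
      m : ℕ
      m = L ∸ (d + d)
      d+d+m≡L : d + (d + m) ≡ L
      d+d+m≡L = trans (sym (ℕₚ.+-assoc d d m)) (ℕₚ.m+[n∸m]≡n (ℕₚ.<⇒≤ 2d<L))
      0<m : 0 < m
      0<m = ℕₚ.m<n⇒0<n∸m 2d<L
      m-odd : m % 2 ≡ 1
      m-odd = trans (sym (odd-sum d m)) (trans (cong (_% 2) d+d+m≡L) L-odd)
      -- Since a is a unit modulo n, n would divide h; but h divides b, so h ≤ b < n. This excludes
      -- the twist 0, for which the lower zone would be empty.
      no-turn : ¬ (+ n ∣ + width g ℤ.* + a)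
      no-turn p = ℕ∣.>⇒∤ h<n (coprime-divisor (gcd≡1⇒coprime a-unit) (subst (n ℕ∣.∣_) (ℕₚ.*-comm (width g) a)
          (subst (n ℕ∣.∣_) (cong ℤ.∣_∣ (sym (ℤₚ.pos-* (width g) a))) (∣⇒∣ᵤ p))))
        where
        h<n : width g < n
        h<n = ℕₚ.≤-<-trans (ℕ∣.∣⇒≤ {{ℕ.>-nonZero 0<b}} (subst (ℕ∣._∣ b) gcd≡h (gcd[m,n]∣n n b))) b<n
      positive : ∀ d → Turn⁻ d ⊎ Turn⁺ d → 0 < d
      positive (suc _) _        = s≤s z≤n
      positive zero    (inj₁ p) = contradiction (subst (+ n ∣_) (lemma (+ width g ℤ.* + a) (+ b)) p) no-turn
        where
        lemma : ∀ x b → x - + 0 ℤ.* b ≡ x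
        lemma = solve-∀
      positive zero    (inj₂ p) = contradiction (subst (+ n ∣_) (lemma (+ width g ℤ.* + a) (+ b)) p) no-turn
        where
        lemma : ∀ x b → x ℤ.+ + 0 ℤ.* b ≡ x
        lemma = solve-∀
      0<d : 0 < d
      0<d = positive d turn

  module _ (3∣n : n % 3 ≡ 0) (coprime : gcd a b ≡ 1) (0<a : 0 < a) (a<b : a < b) (2b<n : b + b < n)
           (a-unit : gcd n a ≡ 1) (b-unit : gcd n b ≡ 1) where
    private
      3ℕ∣n : 3 ℕ∣.∣ n
      3ℕ∣n = ℕ∣.m%n≡0⇒n∣m n 3 3∣n

    units : Pattern n (+ a) (+ b)
    units with turning-number (odd⇒≢double n-odd)
      where open Presentation {a = a} {b = b} {h = 1} {L = n} coprime b-unit (ℕₚ.*-identityˡ n)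
    ... | d , 2d<n , turn with ℕₚ.m≤n⇒m<n∨m≡n 2d<n
    ...   | inj₁ 2d+1<n = pattern± (ℕₚ.<⇒≤ (ℕₚ.≤-<-trans (ℕₚ.m≤m+n d d) 2d<n)) turn
        (line-torus 3∣n n-odd 3∤d 1<d 2d+1<n)
      where
      open Presentation {a = a} {b = b} {h = 1} {L = n} coprime b-unit (ℕₚ.*-identityˡ n)
      b<n : b < n
      b<n = ℕₚ.≤-<-trans (ℕₚ.m≤m+n b b) 2b<n
      3∤a : ¬ (3 ℕ∣.∣ a)
      3∤a p = ℕ∣.>⇒∤ (s≤s (s≤s z≤n)) (subst (3 ℕ∣.∣_) a-unit (gcd-greatest 3ℕ∣n p))
      -- Since a ≡ ± d b modulo n and 3 ∣ n, a factor 3 of d would also divide a, which is a unit.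
      3∤d : d % 3 ≢ 0
      3∤d e = 3∤a (∣⇒∣ᵤ (divisible turn))
        where
        3∣db : ℤ.+ 3 ∣ + d ℤ.* + b
        3∣db = ∣m⇒∣m*n {m = + d} (+ b) (∣ᵤ⇒∣ (ℕ∣.m%n≡0⇒n∣m d 3 e))
        add : ∀ a x → + 1 ℤ.* a - x ℤ.+ x ≡ a
        add = solve-∀
        subtract : ∀ a x → + 1 ℤ.* a ℤ.+ x - x ≡ a
        subtract = solve-∀
        divisible : Turn⁻ d ⊎ Turn⁺ d → + 3 ∣ + a
        divisible (inj₁ p) = subst (+ 3 ∣_) (add (+ a) (+ d ℤ.* + b)) (∣m∣n⇒∣m+n (∣-trans (∣ᵤ⇒∣ 3ℕ∣n) p) 3∣db)
        divisible (inj₂ p) = subst (+ 3 ∣_) (subtract (+ a) (+ d ℤ.* + b)) (∣m∣n⇒∣m-n (∣-trans (∣ᵤ⇒∣ 3ℕ∣n) p) 3∣db)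
      d≢1 : Turn⁻ 1 ⊎ Turn⁺ 1 → a ≡ b ⊎ a + b ≡ 0
      d≢1 (inj₁ p) = inj₁ (congruent⇒≡ (ℕₚ.<-trans a<b b<n) b<n (subst (+ n ∣_) (lemma (+ a) (+ b)) p))
        where
        lemma : ∀ a b → + 1 ℤ.* a - + 1 ℤ.* b ≡ a - b
        lemma = solve-∀
      d≢1 (inj₂ p) = inj₂ (∣-small (subst (+ n ∣_) (lemma (+ a) (+ b)) p) (ℕₚ.<-trans (ℕₚ.+-monoˡ-< b a<b) 2b<n))
        where
        lemma : ∀ a b → + 1 ℤ.* a ℤ.+ + 1 ℤ.* b ≡ a ℤ.+ b
        lemma = solve-∀
      -- The twist 0 is divisible by 3, and the twist 1 would mean a ≡ ± b modulo n, against 0 < a <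
      -- b < n / 2.
      at-least-2 : ∀ d → d % 3 ≢ 0 → Turn⁻ d ⊎ Turn⁺ d → 1 < d
      at-least-2 (suc (suc _)) _   _ = s≤s (s≤s z≤n)
      at-least-2 zero          0≢0 _ = contradiction refl 0≢0
      at-least-2 (suc zero)    _   t with d≢1 t
      ... | inj₁ a≡b   = contradiction a≡b (ℕₚ.<⇒≢ a<b)
      ... | inj₂ a+b≡0 = contradiction (ℕₚ.m+n≡0⇒m≡0 a a+b≡0) (≢-sym (ℕₚ.<⇒≢ 0<a))
      1<d : 1 < d
      1<d = at-least-2 d 3∤d turn
    -- Here a ≡ ± d b with 2d ≡ -1, that is, b ≡ ∓ 2a: exchange the roles of a and b.
    ...   | inj₂ 2d+1≡n = pattern-swap (pattern± 2≤n (exchange turn) (line-torus 3∣n n-odd (λ ())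
        (s≤s (s≤s z≤n)) 5<n))
      where
      open Presentation {a = b} {b = a} {h = 1} {L = n} (trans (gcd-comm b a) coprime) a-unit (ℕₚ.*-identityˡ n)
      3<n : 3 < n
      3<n = ℕₚ.≤-<-trans (ℕₚ.≤-trans (s≤s (s≤s (s≤s z≤n))) (ℕₚ.+-mono-≤ 2≤b 2≤b)) 2b<n
        where
        2≤b : 2 ≤ b
        2≤b = ℕₚ.≤-<-trans 0<a a<b
      5<n : 5 < n
      -- The twist is now m = 2, and `line-torus` asks for 2 m + 1 < n; the only odd multiple of 3
      -- up to 5 is 3.
      5<n = above 3<n n-odd 3∣n
        where
        above : ∀ {n} → 3 < n → n % 2 ≡ 1 → n % 3 ≡ 0 → 5 < n
        above {suc (suc (suc (suc (suc (suc _)))))} _ _ _ = s≤s (s≤s (s≤s (s≤s (s≤s (s≤s z≤n)))))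
        above {suc (suc (suc (suc (suc zero))))} _ _ ()
        above {suc (suc (suc (suc zero)))} _ ()
        above {suc (suc (suc zero))} (s≤s (s≤s (s≤s ())))
        above {suc (suc zero)} (s≤s (s≤s ()))
        above {suc zero} (s≤s ())
      2≤n : 2 ≤ n
      2≤n = ℕₚ.≤-trans (s≤s (s≤s z≤n)) 3<n
      n≡ : ℤ.+ n ≡ + 1 ℤ.+ (+ d ℤ.+ + d)
      n≡ = cong +_ (sym 2d+1≡n)
      n∣nb : ℤ.+ n ∣ (+ 1 ℤ.+ (+ d ℤ.+ + d)) ℤ.* + b
      n∣nb = ∣m⇒∣m*n (+ b) (divides (+ 1) (trans (sym n≡) (sym (ℤₚ.*-identityˡ (+ n)))))
      exchange : (+ n ∣ + 1 ℤ.* + a - + d ℤ.* + b) ⊎ (+ n ∣ + 1 ℤ.* + a ℤ.+ + d ℤ.* + b) → Turn⁻ 2 ⊎ Turn⁺ 2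
      exchange (inj₁ p) = inj₂ (subst (+ n ∣_) (lemma (+ a) (+ b) (+ d)) (∣m∣n⇒∣m+n (∣n⇒∣m*n (+ 2) p) n∣nb))
        where
        lemma : ∀ a b d → + 2 ℤ.* (+ 1 ℤ.* a - d ℤ.* b) ℤ.+ (+ 1 ℤ.+ (d ℤ.+ d)) ℤ.* b ≡ + 1 ℤ.* b ℤ.+ + 2 ℤ.* a
        lemma = solve-∀
      exchange (inj₂ p) = inj₁ (subst (+ n ∣_) (lemma (+ a) (+ b) (+ d)) (∣m∣n⇒∣m-n n∣nb (∣n⇒∣m*n (+ 2) p)))
        where
        lemma : ∀ a b d → (+ 1 ℤ.+ (d ℤ.+ d)) ℤ.* b - + 2 ℤ.* (+ 1 ℤ.* a ℤ.+ d ℤ.* b) ≡ + 1 ℤ.* b - + 2 ℤ.* a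
        lemma = solve-∀

-- Divisors of n are odd, so each gcd is 1 or the width of a grid with at least 3 columns. By
-- hypothesis the cosets of ⟨b⟩ have length 3 s, which settles gcd n b ≥ 3. If b is a unit, the
-- cosets of ⟨a⟩ are considered, whose length may or may not be divisible by 3.
circulant-pattern : ∀ {n a b} → n % 2 ≡ 1 → n % 3 ≡ 0 → gcd a b ≡ 1 → 0 < a → a < b → b + b < n →
  (∃ λ s → gcd n b * (s * 3) ≡ n) → Pattern n (+ a) (+ b)
circulant-pattern {n} {a} {b} n-odd 3∣n coprime 0<a a<b 2b<n (s , eq)
  with odd (odd-factorˡ (gcd n b) (s * 3) (trans (cong (_% 2) eq) n-odd))
... | suc g , gcd≡ = long-cycles n-odd coprime g s (trans (cong (_* (s * 3)) (sym gcd≡)) eq) gcd≡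
... | zero , b-unit with gcd[m,n]∣m n a
...   | ℕ∣.divides L n≡ with odd (odd-factorˡ (gcd n a) L (trans (cong (_% 2) (trans (ℕₚ.*-comm (gcd n a) L)
    (sym n≡))) n-odd))
...     | zero , a-unit = units n-odd 3∣n coprime 0<a a<b 2b<n a-unit b-unit
...     | suc g , gcd≡ = pattern-swap (by-length (L % 3 ℕₚ.≟ 0))
  where
  a<n : a < n
  a<n = ℕₚ.<-trans a<b (ℕₚ.≤-<-trans (ℕₚ.m≤m+n b b) 2b<n)
  coprime′ : gcd b a ≡ 1
  coprime′ = trans (gcd-comm b a) coprime
  hL≡n : width g * L ≡ n
  hL≡n = trans (cong (_* L) (sym gcd≡)) (trans (ℕₚ.*-comm (gcd n a) L) (sym n≡))
  by-length : Dec (L % 3 ≡ 0) → Pattern n (+ b) (+ a)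
  by-length (yes p) = long-cycles n-odd coprime′ g (L / 3)
    (trans (cong (width g *_) (sym (trans (m≡m%n+[m/n]*n L 3) (cong (_+ L / 3 * 3) p)))) hL≡n) gcd≡
  by-length (no ¬p) = short-cycles n-odd coprime′ 0<a a<n g L hL≡n gcd≡ b-unit ¬p

theorem2p2 : (p a b : ℕ) → (∃ λ k → p ≡ 2 * k + 1) →
    1 ≤ a → a < b → b ≤ (3 * p ∸ 1) / 2 → gcd a b ≡ 1 →
    (∃ λ s → 1 ≤ s × (3 * s) * gcd (3 * p) b ≡ 3 * p) →
    TotalChromaticNumber≡ (Circulant₂ (3 * p) a b) 5
theorem2p2 p a b (k , refl) 1≤a a<b b≤ coprime (s , _ , 3s*g≡n) =
  total-colouring 1≤a a<b 2b<n (circulant-pattern n-odd 3∣n coprime 1≤a a<b 2b<n (s , g*3s≡n)) ,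
  no-fewer-colours 1≤a a<b 2b<n
  where
  n : ℕ
  n = 3 * p
  p-odd : p % 2 ≡ 1
  p-odd = trans (cong (_% 2) (trans (ℕₚ.+-comm (2 * k) 1) (cong suc (ℕₚ.*-comm 2 k)))) ([m+kn]%n≡m%n 1 k 2)
  n-odd : n % 2 ≡ 1
  n-odd = trans (%-distribˡ-* 3 p 2) (cong (λ r → (1 * r) % 2) p-odd)
  3∣n : n % 3 ≡ 0
  3∣n = trans (cong (_% 3) (ℕₚ.*-comm 3 p)) (m*n%n≡0 p 3)
  0<n : 0 < n
  0<n = ℕₚ.n≢0⇒n>0 λ n≡0 → contradiction (trans (sym n-odd) (cong (_% 2) n≡0)) λ ()
  b+b≡b*2 : b + b ≡ b * 2
  b+b≡b*2 = trans (cong (_+_ b) (sym (ℕₚ.+-identityʳ b))) (ℕₚ.*-comm 2 b)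
  2b<n : b + b < n
  2b<n = ℕₚ.≤-<-trans (ℕₚ.≤-trans (ℕₚ.≤-reflexive b+b≡b*2) (ℕₚ.≤-trans (ℕₚ.*-monoˡ-≤ 2 b≤) (m/n*n≤m (n ∸ 1) 2)))
    (ℕₚ.∸-monoʳ-< {n} (s≤s z≤n) 0<n)
  g*3s≡n : gcd n b * (s * 3) ≡ n
  g*3s≡n = trans (ℕₚ.*-comm (gcd n b) (s * 3)) (trans (cong (_* gcd n b) (ℕₚ.*-comm s 3)) 3s*g≡n)
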